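{- Let $\varphi\in\mathrm{Fml}_B(\mathcal L_D)$ be a bounded formula with free variables $\vec x$, let $\mathcal F$ be an approximation of $\varphi$, let $0<\delta<\frac12$ be a rational constant and let $I:\mathrm{Term}(\varphi)\to\mathbb{IQ}$ be an enclosure of $\varphi$. Consider the two proof rules with the common premise $$\vdash\bigwedge_{f(e)\in\mathrm{Term}_F(\varphi)}\forall^{I_e}s\,\big(|\mathcal F_{f(e)}(s)-f(s)|\le\delta\big)$$ and conclusions, respectively, $$(\delta^\forall)\quad\vdash\forall^{I_{\vec x}}\vec x\,\big(\mathcal A^\forall_{\mathcal F}(\varphi,\delta)\to\varphi\big),\qquad(\delta^\exists)\quad\vdash\forall^{I_{\vec x}}\vec x\,\big(\varphi\to\mathcal A^\exists_{\mathcal F}(\varphi,\delta)\big).$$ Both proof rules are sound. If $I$ is furthermore a provable enclosure, then both proof rules are derivable (in dL).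
   Context: DIFFERENTIAL DYNAMIC LOGIC (dL), continuous fragment. Terms are built from real variables, rational constants, $+$, $\cdot$ and function symbols. Formulas are built from comparisons $p\sim q$ ($\sim\in\{=,\neq,\ge,>,\le,<\}$) by the propositional connectives, quantifiers over $\mathbb R$, and modalities $[x'=f(x)\&Q]P$ and $\langle x'=f(x)\&Q\rangle P$, where $x$ is a vector of variables and $Q$ a formula of first-order real arithmetic (omitted $Q$ means true). Let $\Phi_\omega:[0,\tau_{\max})\to$ states be the right-maximal solution of $x'=f(x)$ from state $\omega$. Then $\omega\models[x'=f(x)\&Q]P$ iff $\Phi_\omega(\tau)\models P$ for all $\tau\in[0,\tau_{\max})$ such that $\Phi_\omega(\xi)\models Q$ for all $\xi\in[0,\tau]$; and $\omega\models\langle x'=f(x)\&Q\rangle P$ iff $\Phi_\omega(\tau)\models P$ for some such $\tau$. Valid means true in all states. A proof rule is sound if validity of its premises entails validity of its conclusion. A formula is provable in dL, and a rule derivable in dL, if it can be derived (for a rule: its conclusion from its premise) in the classical first-order sequent calculus (with cut) from the axioms and rules of dL, listed as follows ($\alpha$ an ODE; $y$ fresh in Cont, Dadj, BDG): ($\mathbb R$) every sequent valid in first-order real arithmetic; $\langle\alpha\rangle P\leftrightarrow\neg[\alpha]\neg P$; $\langle x'=f(x)\rangle p(x)\leftrightarrow\exists t{\ge}0\,p(y(t))$ where $y'(t)=f(y)$ (symbolic solution from initial value $x$); $\langle x'=f(x)\&Q(x)\rangle\exists y\,P(x,y)\leftrightarrow\exists y\langle x'=f(x)\&Q(x)\rangle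 P(x,y)$ if $y\notin x$; (K) $[\alpha](P\to R)\to([\alpha]P\to[\alpha]R)$; (V) $P\to[\alpha]P$ if no free variable of $P$ is bound by $\alpha$; (G) from $\vdash P$ infer $\Gamma\vdash[\alpha]P$; (dW) from $Q\vdash P$ infer $\Gamma\vdash[x'=f(x)\&Q]P$; (dC) from $\Gamma\vdash[x'=f(x)\&Q]C$ and $\Gamma\vdash[x'=f(x)\&Q\wedge C]P$ infer $\Gamma\vdash[x'=f(x)\&Q]P$; (DG) $[x'=f(x)\&Q(x)]P(x)\leftrightarrow\exists y[x'=f(x),y'=a(x)y+b(x)\&Q(x)]P(x)$; (DGi) $[x'=f(x)\&Q(x)]P(x)\to\forall y[x'=f(x),y'=g(x,y)\&Q(x)]P(x)$; (DX) $[x'=f(x)\&Q]P\leftrightarrow(Q\to P\wedge[x'=f(x)\&Q]P)$ if $x'\notin P,Q$; (Uniq) $\langle x'=f(x)\&Q_1\wedge Q_2\rangle P\leftrightarrow\langle x'=f(x)\&Q_1\rangle P\wedge\langle x'=f(x)\&Q_2\rangle P$; (Cont) $x=y\to(\langle x'=f(x)\&e>0\rangle x\neq y\leftrightarrow e>0)$ if $f(x)\ne0$; (Dadj) $\langle x'=f(x)\&Q(x)\rangle x=y\leftrightarrow\langle y'=-f(y)\&Q(y)\rangle y=x$; (RI) $[x'=f(x)]P\leftrightarrow\forall y[x'=f(x)\&P\vee x=y](x=y\to P\wedge\langle x'=f(x)\&P\vee x=y\rangle x\ne y)$; (BDG) $[x'=f(x),y'=g(x,y)\&Q(x)]\|y\|^2\le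 p(x)\to([x'=f(x)\&Q(x)]P(x)\leftrightarrow[x'=f(x),y'=g(x,y)\&Q(x)]P(x))$ with $Q(x)$ a formula of real arithmetic; (FI) $e_0=h(e_1)\leftrightarrow\phi_h(e_0,e_1)$ for each differentially-defined function symbol $h$ with defining formula $\phi_h$ as follows. DIFFERENTIALLY-DEFINED FUNCTIONS. Each is a unary symbol $h$ given by $f\in\mathbb Q[x]^{n+1}$, $x=(x_0,\dots,x_n)$, $X\in\mathbb Q^{n+1}$, $T_0\in\mathbb Q$, with defining formula $\phi_h(x_0,t)\equiv\exists x_1\cdots x_n(\langle x'=-f(x),t'=-1\rangle(x=X\wedge t=T_0)\vee\langle x'=f(x),t'=1\rangle(x=X\wedge t=T_0))$, such that global existence, $\exists x_0\,\phi_h(x_0,t)$, is provable in dL. It is interpreted as $h:\mathbb R\to\mathbb R$, the $x_0$-coordinate of the global solution of $x'=f(x)$, $x(T_0)=X$. LANGUAGE. $\mathbb R_D$ is the real-closed field $\mathbb R$ expanded by all these functions; $\mathcal L_D$ is its language (rational constants, $+,\cdot,\ge,>$, and these unary symbols). $\mathrm{FOL}_{\mathbb R}$ is the set of first-order formulas of real arithmetic (without these function symbols); functions definable in it may be used in formulas. Atomic formulas have the form $t\ge0$ or $t>0$. Bounded quantifiers are $\exists^{[a,b]}y\,\chi:=\exists y(a\le y\wedge y\le b\wedge\chi)$ and $\forall^{[a,b]}y\,\chi:=\forall y(a\le y\wedge y\le b\to\chi)$. A bounded formula is $Q_1^{[a_1,b_1]}y_1\cdots Q_n^{[a_n,b_n]}y_n\,\psi$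 with $Q_i\in\{\exists,\forall\}$, $\psi$ quantifier-free in conjunctive normal form, where the $[a_i,b_i]$ are closed intervals whose endpoints are terms (assumed, without loss of generality, to contain no function symbols) that may depend on variables appearing before $y_i$. $\mathrm{Fml}_B(\mathcal L_D)$ is the set of bounded formulas. ENCLOSURES. $\mathbb{IQ}$ is the set of intervals $[\underline a,\overline a]$ with $\underline a\le\overline a$ in $\mathbb Q$. $\mathrm{Term}(\varphi)$ is the set of terms appearing in $\varphi$, $\mathrm{Term}_F(\varphi)$ the set of those of the form $f(e)$ with $f$ a function symbol. For $\varepsilon\in\mathbb Q^+$, an $\varepsilon$-enclosure of $\varphi$ is a function $I:\mathrm{Term}(\varphi)\to\mathbb{IQ}$, $e\mapsto I_e$, satisfying: for a free variable $x$, no requirement on $I_x\in\mathbb{IQ}$; for a variable $y$ bound via $Q^{[a,b]}y$, $I_a\cup I_b\subseteq I_y$; $I_{t_1}+I_{t_2}\subseteq I_{t_1+t_2}$ and $I_{t_1}\cdot I_{t_2}\subseteq I_{t_1\cdot t_2}$ (usual interval arithmetic); $f(I_e)+[-\varepsilon,\varepsilon]\subseteq I_{f(e)}$, where $f(I_e)$ is the image of $I_e$ under the interpretation of $f$. It is provable if these conditions are provable in dL. An enclosure is a $1$-enclosure. $\forall^{I_{\vec x}}\vec x$ abbreviates $\forall^{I_{x_1}}x_1\cdots\forall^{I_{x_n}}x_n$. APPROXIMATIONS. An approximation $\mathcal F$ of $\varphi$ assigns to each $f(e)\in\mathrm{Term}_F(\varphi)$ an $\mathrm{FOL}_{\mathbb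 R}$ formula defining a function $\mathcal F_{f(e)}:\mathbb R\to\mathbb R$. PERTURBATIONS. $\mathcal A^\forall_{\mathcal F}(\varphi,\delta)$ is defined inductively: it is $\varphi$ if $\varphi$ is atomic without function symbols; for atomic $t(f(e),\vec x)\succeq0$ ($\succeq\in\{\ge,>\}$, $e$ without function symbols) it is $\forall^{[\mathcal F_{f(e)}(e)-\delta,\ \mathcal F_{f(e)}(e)+\delta]}w\ \mathcal A^\forall_{\mathcal F_{w\mapsto f(e)}}(t(w,\vec x)\succeq0,\delta)$, where $w$ is fresh and replaces $f(e)$, and $\mathcal F_{w\mapsto f(e)}(\theta(w,\vec x)):=\mathcal F(\theta(f(e),\vec x))$; it commutes with $\wedge,\vee$ and bounded quantifiers. $\mathcal A^\exists_{\mathcal F}(\varphi,\delta)$ is defined identically with $\exists w$ in place of $\forall w$.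
   Formalization: An enclosure must also satisfy q ∈ I_q for rational constants q (otherwise f(5)≥0 with I_5=[0,0] refutes soundness), and axiom RI carries the antecedent [x'=f(x)] f(x)≠0, since as listed it fails for x'=0 and makes dL inconsistent. -}

module Defs where

open import Algebra.Bundles using (CommutativeRing)
open import Algebra.Morphism.Structures using (IsRingHomomorphism)
open import Data.Empty using (⊥)
open import Data.Fin.Base using (Fin; toℕ) renaming (zero to fzero)
open import Data.Fin.Properties using (toℕ-injective)
open import Data.List.Base as List using (List; []; _∷_; _++_; concatMap; filter; foldr)
open import Data.List.Membership.Propositional using (_∈_; _∉_)
open import Data.List.Relation.Binary.Disjoint.Propositional using (Disjoint)
open import Data.List.Relation.Binary.Permutation.Propositional using (_↭_)
open import Data.List.Relation.Binary.Subset.Propositional using (_⊆_)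
open import Data.List.Relation.Unary.All using (All)
open import Data.List.Relation.Unary.Any using (Any)
open import Data.Nat.Base as ℕ using (ℕ; zero; suc)
open import Data.Nat.Properties using (_≟_; +-cancelˡ-≡)
open import Data.Product using (Σ; ∃; ∃!; _×_; _,_)
open import Data.Rational.Base as ℚ using (ℚ; 0ℚ; 1ℚ)
open import Data.Sum.Base using (_⊎_; [_,_]′)
open import Data.Unit.Base using (⊤)
open import Data.Vec.Base as Vec using (Vec; []; _∷_; toList; lookup)
open import Data.Vec.Relation.Unary.Unique.Propositional using (Unique)
import Data.Vec.Relation.Unary.Unique.Propositional.Properties as Unique
open import Function.Base using (_∘_; id)
open import Function.Bundles using (_↣_; mk↣; Injection)
open import Level using (0ℓ) renaming (suc to lsuc)
open import Relation.Binary.Core using (Rel)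
open import Relation.Binary.PropositionalEquality using (_≡_; _≢_; refl; sym; trans; cong)
open import Relation.Binary.Structures using (IsTotalOrder)
import Relation.Binary.Construct.Add.Supremum.Strict as Strict
import Relation.Binary.Construct.NonStrictToStrict as ToStrict
open import Relation.Nullary using (¬_; yes; no; contradiction)
open import Relation.Nullary.Construct.Add.Supremum using (_⁺; [_])
open import Relation.Nullary.Decidable using (¬?)

-- A Dedekind-complete totally ordered field.  Classically there is exactly
-- one up to isomorphism.  The embedding of ℚ is determined by the other
-- fields and is included only for convenience.
record RealNumbers : Set (lsuc 0ℓ) where
  infix 4 _≤_
  field
    commutativeRing : CommutativeRing 0ℓ 0ℓ
  open CommutativeRing commutativeRing public
    using (Carrier; _≈_; _+_; _*_; -_; _-_; 0#; 1#; rawRing)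
  field
    _≤_          : Rel Carrier 0ℓ
    isTotalOrder : IsTotalOrder _≈_ _≤_
    +-monoˡ-≤    : ∀ z {x y} → x ≤ y → x + z ≤ y + z
    *-nonNeg     : ∀ {x y} → 0# ≤ x → 0# ≤ y → 0# ≤ x * y
    0≉1          : ¬ 0# ≈ 1#
    inverse      : ∀ x → ¬ x ≈ 0# → ∃ λ y → x * y ≈ 1#
    supremum     : (P : Carrier → Set) → ∃ P → (∃ λ b → ∀ x → P x → x ≤ b) →
                   ∃ λ s → (∀ x → P x → x ≤ s) ×
                           (∀ b → (∀ x → P x → x ≤ b) → s ≤ b)
    fromℚ        : ℚ → Carrier
    fromℚ-isRingHomomorphism : IsRingHomomorphism ℚ.+-*-rawRing rawRing fromℚ

  open IsTotalOrder isTotalOrder public using (total)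
  open ToStrict _≈_ _≤_ public using (_<_)

  ∣_∣ : Carrier → Carrier
  ∣ x ∣ = [ (λ _ → x) , (λ _ → - x) ]′ (total 0# x)

Var : Set
Var = ℕ

_[_≔_] : ∀ {A : Set} → (Var → A) → Var → A → Var → A
(f [ x ≔ a ]) v with v ≟ x
... | yes _ = a
... | no  _ = f v

-- Terms with function symbols from S and variables from V.  Terms over
-- S = ⊥ are the terms without function symbols.
data Term (S V : Set) : Set where
  var     : V → Term S V
  con     : ℚ → Term S V
  _⊕_ _⊗_ : Term S V → Term S V → Term S V
  fn      : S → Term S V → Term S V

infixl 7 _⊗_
infixl 6 _⊕_

bind : ∀ {S V W} → (V → Term S W) → Term S V → Term S W
bind σ (var x)  = σ x
bind σ (con q)  = con q
bind σ (s ⊕ t)  = bind σ s ⊕ bind σ t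
bind σ (s ⊗ t)  = bind σ s ⊗ bind σ t
bind σ (fn h t) = fn h (bind σ t)

liftTerm : ∀ {S V} → Term ⊥ V → Term S V
liftTerm (var x) = var x
liftTerm (con q) = con q
liftTerm (s ⊕ t) = liftTerm s ⊕ liftTerm t
liftTerm (s ⊗ t) = liftTerm s ⊗ liftTerm t

neg : ∀ {S V} → Term S V → Term S V
neg t = con (ℚ.- 1ℚ) ⊗ t

fvTerm : ∀ {S V} → Term S V → List V
fvTerm (var x)  = x ∷ []
fvTerm (con q)  = []
fvTerm (s ⊕ t)  = fvTerm s ++ fvTerm t
fvTerm (s ⊗ t)  = fvTerm s ++ fvTerm t
fvTerm (fn h t) = fvTerm t

data Cmp : Set where
  equal unequal geq greater leq less : Cmp

-- The system vars′ = rhs.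
record ODE (S : Set) : Set where
  constructor ode
  field
    {dim}   : ℕ
    vars    : Vec Var dim
    rhs     : Vec (Term S Var) dim
    .unique : Unique vars

data Kind : Set where
  fo dl : Kind

-- First-order formulas (fo) and formulas of dL (dl).  First-order formulas
-- of real arithmetic without function symbols are the type Fml ⊥ fo.
data Fml (S : Set) : Kind → Set where
  cmp              : ∀ {k} → Cmp → Term S Var → Term S Var → Fml S k
  ¬̇_               : ∀ {k} → Fml S k → Fml S k
  _∧̇_ _∨̇_ _→̇_      : ∀ {k} → Fml S k → Fml S k → Fml S k
  ∀̇_∙_ ∃̇_∙_        : ∀ {k} → Var → Fml S k → Fml S k
  [_&_]_ ⟨_&_⟩_    : ODE S → Fml S fo → Fml S dl → Fml S dl

infix  8 ¬̇_
infixr 7 _∧̇_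
infixr 6 _∨̇_
infixr 5 _→̇_
infix  5 _↔̇_
infixr 4 ∀̇_∙_ ∃̇_∙_
infixr 8 [_&_]_ ⟨_&_⟩_
infix  9 _≐_ _≤̇_ _≥̇_ _>̇_

_≐_ _≤̇_ _≥̇_ _>̇_ : ∀ {S k} → Term S Var → Term S Var → Fml S k
_≐_ = cmp equal
_≤̇_ = cmp leq
_≥̇_ = cmp geq
_>̇_ = cmp greater

_↔̇_ : ∀ {S k} → Fml S k → Fml S k → Fml S k
φ ↔̇ ψ = (φ →̇ ψ) ∧̇ (ψ →̇ φ)

true : ∀ {S k} → Fml S k
true = con 0ℚ ≐ con 0ℚ

⋀ : ∀ {S k} → List (Fml S k) → Fml S k
⋀ = foldr _∧̇_ true

∀* ∃* : ∀ {S k n} → Vec Var n → Fml S k → Fml S k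
∀* []       φ = φ
∀* (x ∷ xs) φ = ∀̇ x ∙ ∀* xs φ
∃* []       φ = φ
∃* (x ∷ xs) φ = ∃̇ x ∙ ∃* xs φ

_≐*_ : ∀ {S k n} → Vec (Term S Var) n → Vec (Term S Var) n → Fml S k
ss ≐* ts = ⋀ (toList (Vec.zipWith _≐_ ss ts))

infix 9 _≐*_

embed : ∀ {S T k} → (Term S Var → Term T Var) → Fml S fo → Fml T k
embed g (cmp c s t) = cmp c (g s) (g t)
embed g (¬̇ φ)       = ¬̇ embed g φ
embed g (φ ∧̇ ψ)     = embed g φ ∧̇ embed g ψ
embed g (φ ∨̇ ψ)     = embed g φ ∨̇ embed g ψ
embed g (φ →̇ ψ)     = embed g φ →̇ embed g ψ
embed g (∀̇ x ∙ φ)   = ∀̇ x ∙ embed g φ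
embed g (∃̇ x ∙ φ)   = ∃̇ x ∙ embed g φ

⇑ : ∀ {S k} → Fml S fo → Fml S k
⇑ = embed id

lift : ∀ {S k} → Fml ⊥ fo → Fml S k
lift = embed liftTerm

remove : Var → List Var → List Var
remove x = filter (λ v → ¬? (v ≟ x))

boundVars : ∀ {S} → ODE S → List Var
boundVars α = toList (ODE.vars α)

fvRhs : ∀ {S n} → Vec (Term S Var) n → List Var
fvRhs es = concatMap fvTerm (toList es)

fv : ∀ {S k} → Fml S k → List Var
-- The variables of an ODE are bound by it but also occur free, through
-- their initial values.
fvModal : ∀ {S} → ODE S → Fml S fo → Fml S dl → List Var

fv (cmp _ s t)   = fvTerm s ++ fvTerm t
fv (¬̇ φ)         = fv φ
fv (φ ∧̇ ψ)       = fv φ ++ fv ψ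
fv (φ ∨̇ ψ)       = fv φ ++ fv ψ
fv (φ →̇ ψ)       = fv φ ++ fv ψ
fv (∀̇ x ∙ φ)     = remove x (fv φ)
fv (∃̇ x ∙ φ)     = remove x (fv φ)
fv ([ α & Q ] P) = fvModal α Q P
fv (⟨ α & Q ⟩ P) = fvModal α Q P

fvModal α Q P = boundVars α ++ fvRhs (ODE.rhs α) ++ fv Q ++ fv P

-- Injective renaming of all variables, bound ones included.
module _ {S : Set} (ρ : Var ↣ Var) where
  private
    r : Var → Var
    r = Injection.to ρ

  renameTerm : Term S Var → Term S Var
  renameTerm = bind (var ∘ r)

  renameODE : ODE S → ODE S
  renameODE (ode xs es u) =
    ode (Vec.map r xs) (Vec.map renameTerm es) (Unique.map⁺ (Injection.injective ρ) u)

  rename : ∀ {k} → Fml S k → Fml S k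
  rename (cmp c s t)   = cmp c (renameTerm s) (renameTerm t)
  rename (¬̇ φ)         = ¬̇ rename φ
  rename (φ ∧̇ ψ)       = rename φ ∧̇ rename ψ
  rename (φ ∨̇ ψ)       = rename φ ∨̇ rename ψ
  rename (φ →̇ ψ)       = rename φ →̇ rename ψ
  rename (∀̇ x ∙ φ)     = ∀̇ r x ∙ rename φ
  rename (∃̇ x ∙ φ)     = ∃̇ r x ∙ rename φ
  rename ([ α & Q ] P) = [ renameODE α & rename Q ] rename P
  rename (⟨ α & Q ⟩ P) = ⟨ renameODE α & rename Q ⟩ rename P

shift : ℕ → Var ↣ Var
shift N = mk↣ {to = N ℕ.+_} (+-cancelˡ-≡ N _ _)

swapVar : Var → Var → Var → Var
swapVar x y = (id [ y ≔ x ]) [ x ≔ y ]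

swapVar-involutive : ∀ x y v → swapVar x y (swapVar x y v) ≡ v
swapVar-involutive x y v with v ≟ x
swapVar-involutive x y v | yes v≡x with y ≟ x
... | yes y≡x = trans y≡x (sym v≡x)
... | no  _   with y ≟ y
...   | yes _   = sym v≡x
...   | no  y≢y = contradiction refl y≢y
swapVar-involutive x y v | no v≢x with v ≟ y
swapVar-involutive x y v | no v≢x | yes v≡y with x ≟ x
... | yes _   = sym v≡y
... | no  x≢x = contradiction refl x≢x
swapVar-involutive x y v | no v≢x | no v≢y with v ≟ x
... | yes v≡x = contradiction v≡x v≢x
... | no  _   with v ≟ y
...   | yes v≡y = contradiction v≡y v≢y
...   | no  _   = refl

swap : Var → Var → Var ↣ Var
swap x y = mk↣ {to = swapVar x y} λ {u} {v} e →
  trans (sym (swapVar-involutive x y u))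
        (trans (cong (swapVar x y) e) (swapVar-involutive x y v))

Subst : Set → Set
Subst S = Var → Term S Var

_↦*_ : ∀ {S n} → Vec Var n → Vec (Term S Var) n → Subst S
[]       ↦* []       = var
(x ∷ xs) ↦* (e ∷ es) = (xs ↦* es) [ x ≔ e ]

_↦_ : ∀ {S} → Var → Term S Var → Subst S
x ↦ e = (x ∷ []) ↦* (e ∷ [])

_except_ : ∀ {S} → Subst S → Var → Subst S
σ except x = σ [ x ≔ var x ]

-- Simultaneous substitution.  It does not rename bound variables, and is
-- meaningful only under Admissible.
subst : ∀ {S k} → Subst S → Fml S k → Fml S k
substODE : ∀ {S} → Subst S → ODE S → ODE S

subst σ (cmp c s t)   = cmp c (bind σ s) (bind σ t)
subst σ (¬̇ φ)         = ¬̇ subst σ φ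
subst σ (φ ∧̇ ψ)       = subst σ φ ∧̇ subst σ ψ
subst σ (φ ∨̇ ψ)       = subst σ φ ∨̇ subst σ ψ
subst σ (φ →̇ ψ)       = subst σ φ →̇ subst σ ψ
subst σ (∀̇ x ∙ φ)     = ∀̇ x ∙ subst (σ except x) φ
subst σ (∃̇ x ∙ φ)     = ∃̇ x ∙ subst (σ except x) φ
subst σ ([ α & Q ] P) = [ substODE σ α & subst σ Q ] subst σ P
subst σ (⟨ α & Q ⟩ P) = ⟨ substODE σ α & subst σ Q ⟩ subst σ P

substODE σ (ode xs es u) = ode xs (Vec.map (bind σ) es) u

-- No capture by quantifiers or ODEs, and no replacement of a variable that
-- an ODE binds.
Admissible : ∀ {S k} → Subst S → Fml S k → Set
AdmissibleBinder : ∀ {S k} → Subst S → Var → Fml S k → Set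
AdmissibleModal : ∀ {S} → Subst S → ODE S → Fml S fo → Fml S dl → Set

Admissible σ (cmp _ _ _)   = ⊤
Admissible σ (¬̇ φ)         = Admissible σ φ
Admissible σ (φ ∧̇ ψ)       = Admissible σ φ × Admissible σ ψ
Admissible σ (φ ∨̇ ψ)       = Admissible σ φ × Admissible σ ψ
Admissible σ (φ →̇ ψ)       = Admissible σ φ × Admissible σ ψ
Admissible σ (∀̇ x ∙ φ)     = AdmissibleBinder σ x φ
Admissible σ (∃̇ x ∙ φ)     = AdmissibleBinder σ x φ
Admissible σ ([ α & Q ] P) = AdmissibleModal σ α Q P
Admissible σ (⟨ α & Q ⟩ P) = AdmissibleModal σ α Q P

AdmissibleBinder σ x φ =
  (∀ {v} → v ∈ fv φ → v ≢ x → x ∉ fvTerm (σ v)) × Admissible (σ except x) φ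

AdmissibleModal σ α Q P =
  (∀ {v} → v ∈ boundVars α → σ v ≡ var v) ×
  (∀ {v} → v ∈ fvModal α Q P → v ∉ boundVars α → Disjoint (boundVars α) (fvTerm (σ v))) ×
  Admissible σ Q × Admissible σ P

module Semantics (ℝ : RealNumbers) where
  open RealNumbers ℝ
  open Strict _<_ using (_<⁺_)

  HasDerivative : (D : Carrier → Set) → (Carrier → Carrier) → Carrier → Carrier → Set
  HasDerivative D g g′ τ =
    ∀ ε → 0# < ε → ∃ λ η → 0# < η ×
      (∀ σ → D σ → ∣ σ - τ ∣ < η → ∣ (g σ - g τ) - g′ * (σ - τ) ∣ ≤ ε * ∣ σ - τ ∣)

  State : Set
  State = Var → Carrier

  -- J interprets the function symbols.
  module _ {S : Set} (J : S → Carrier → Carrier) where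

    ⟦_⟧ : ∀ {V} → Term S V → (V → Carrier) → Carrier
    ⟦ var x ⟧  ω = ω x
    ⟦ con q ⟧  ω = fromℚ q
    ⟦ s ⊕ t ⟧  ω = ⟦ s ⟧ ω + ⟦ t ⟧ ω
    ⟦ s ⊗ t ⟧  ω = ⟦ s ⟧ ω * ⟦ t ⟧ ω
    ⟦ fn h t ⟧ ω = J h (⟦ t ⟧ ω)

    ⟦_⟧ᶜ : Cmp → Carrier → Carrier → Set
    ⟦ equal   ⟧ᶜ a b = a ≈ b
    ⟦ unequal ⟧ᶜ a b = ¬ a ≈ b
    ⟦ geq     ⟧ᶜ a b = b ≤ a
    ⟦ greater ⟧ᶜ a b = b < a
    ⟦ leq     ⟧ᶜ a b = a ≤ b
    ⟦ less    ⟧ᶜ a b = a < b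

    Before : Carrier ⁺ → Carrier → Set
    Before T τ = 0# ≤ τ × [ τ ] <⁺ T

    -- Φ solves α on [0,T) from ω, where T may be infinite.
    record IsSolution (α : ODE S) (ω : State) (T : Carrier ⁺) (Φ : Carrier → State) : Set where
      open ODE α
      field
        initial  : ∀ v → Φ 0# v ≈ ω v
        constant : ∀ τ → Before T τ → ∀ v → v ∉ boundVars α → Φ τ v ≈ ω v
        flow     : ∀ τ → Before T τ → ∀ i →
                   HasDerivative (Before T) (λ σ → Φ σ (lookup vars i)) (⟦ lookup rhs i ⟧ (Φ τ)) τ

    record IsRightMaximal (α : ODE S) (ω : State) (T : Carrier ⁺) (Φ : Carrier → State) : Set where
      field
        positive   : [ 0# ] <⁺ T
        isSolution : IsSolution α ω T Φ
        maximal    : ∀ T′ Ψ → T <⁺ T′ → IsSolution α ω T′ Ψ →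
                     ¬ (∀ τ → Before T τ → ∀ v → Ψ τ v ≈ Φ τ v)

    infix 3 _⊨_

    _⊨_ : ∀ {k} → State → Fml S k → Set
    ω ⊨ cmp c s t   = ⟦ c ⟧ᶜ (⟦ s ⟧ ω) (⟦ t ⟧ ω)
    ω ⊨ ¬̇ φ         = ¬ (ω ⊨ φ)
    ω ⊨ φ ∧̇ ψ       = (ω ⊨ φ) × (ω ⊨ ψ)
    ω ⊨ φ ∨̇ ψ       = (ω ⊨ φ) ⊎ (ω ⊨ ψ)
    ω ⊨ φ →̇ ψ       = (ω ⊨ φ) → (ω ⊨ ψ)
    ω ⊨ ∀̇ x ∙ φ     = ∀ a → ω [ x ≔ a ] ⊨ φ
    ω ⊨ ∃̇ x ∙ φ     = ∃ λ a → ω [ x ≔ a ] ⊨ φ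
    ω ⊨ ([ α & Q ] P) =
      ∀ T Φ → IsRightMaximal α ω T Φ → ∀ τ → Before T τ →
      (∀ ξ → 0# ≤ ξ → ξ ≤ τ → Φ ξ ⊨ Q) → Φ τ ⊨ P
    ω ⊨ (⟨ α & Q ⟩ P) =
      ∃ λ T → ∃ λ Φ → IsRightMaximal α ω T Φ × ∃ λ τ → Before T τ ×
      (∀ ξ → 0# ≤ ξ → ξ ≤ τ → Φ ξ ⊨ Q) × (Φ τ ⊨ P)

    Valid : ∀ {k} → Fml S k → Set
    Valid φ = ∀ ω → ω ⊨ φ

    SoundRule : (premise conclusion : Fml S dl) → Set
    SoundRule P C = Valid P → Valid C

    ValidSequent : ∀ {k} → List (Fml S k) → List (Fml S k) → Set
    ValidSequent Γ Δ = ∀ ω → All (ω ⊨_) Γ → Any (ω ⊨_) Δ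

    -- The terms es, in the time variable t, solve xs′ = fs from xs on [0,∞).
    SymbolicSolution : ∀ {n} → Vec Var n → Vec (Term S Var) n → Var → Vec (Term S Var) n → Set
    SymbolicSolution xs fs t es = ∀ ω i →
      (⟦ lookup es i ⟧ (ω [ t ≔ 0# ]) ≈ ω (lookup xs i)) ×
      (∀ τ → 0# ≤ τ →
        HasDerivative (0# ≤_) (λ σ → ⟦ lookup es i ⟧ (ω [ t ≔ σ ]))
                      (⟦ bind (xs ↦* es) (lookup fs i) ⟧ (ω [ t ≔ τ ])) τ)

  J⊥ : ⊥ → Carrier → Carrier
  J⊥ ()

module Calculus (ℝ : RealNumbers) {S : Set}
                (J : S → RealNumbers.Carrier ℝ → RealNumbers.Carrier ℝ)
                (FunctionAxiom : Fml S dl → Set) where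
  open Semantics ℝ

  data Axiom : Fml S dl → Set where
    Leibniz : ∀ x s t φ → Admissible (x ↦ s) φ → Admissible (x ↦ t) φ →
              Axiom (s ≐ t →̇ subst (x ↦ s) φ →̇ subst (x ↦ t) φ)

    dual : ∀ α Q P → Axiom (⟨ α & Q ⟩ P ↔̇ ¬̇ [ α & Q ] ¬̇ P)

    solve : ∀ {n} (xs : Vec Var n) fs .(u : Unique xs) t es P →
            t ∉ toList xs → t ∉ fvRhs fs → t ∉ fv P →
            SymbolicSolution J xs fs t es → Admissible (xs ↦* es) P →
            Axiom (⟨ ode xs fs u & true ⟩ P ↔̇
                   (∃̇ t ∙ (var t ≥̇ con 0ℚ ∧̇ subst (xs ↦* es) P)))

    Barcan : ∀ α Q y P → y ∉ boundVars α → y ∉ fvRhs (ODE.rhs α) → y ∉ fv Q →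
             Axiom (⟨ α & Q ⟩ (∃̇ y ∙ P) ↔̇ (∃̇ y ∙ ⟨ α & Q ⟩ P))

    K : ∀ α Q P R → Axiom ([ α & Q ] (P →̇ R) →̇ [ α & Q ] P →̇ [ α & Q ] R)

    V : ∀ α Q P → Disjoint (fv P) (boundVars α) → Axiom (P →̇ [ α & Q ] P)

    DG : ∀ {n} (xs : Vec Var n) fs .(u : Unique xs) y a b Q P .(u′ : Unique (y ∷ xs)) →
         y ∉ fvRhs fs → y ∉ fvTerm a → y ∉ fvTerm b → y ∉ fv Q → y ∉ fv P →
         Axiom ([ ode xs fs u & Q ] P ↔̇
                (∃̇ y ∙ [ ode (y ∷ xs) ((a ⊗ var y ⊕ b) ∷ fs) u′ & Q ] P))

    DGi : ∀ {m n} (xs : Vec Var n) fs .(u : Unique xs) (ys : Vec Var m) gs Q P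
          .(u′ : Unique (ys Vec.++ xs)) →
          Disjoint (toList ys) (fvRhs fs) → Disjoint (toList ys) (fv Q) →
          Disjoint (toList ys) (fv P) →
          Axiom ([ ode xs fs u & Q ] P →̇
                 ∀* ys ([ ode (ys Vec.++ xs) (gs Vec.++ fs) u′ & Q ] P))

    -- Differential symbols x′ do not occur in terms, so there is no side
    -- condition.
    DX : ∀ α Q P → Axiom ([ α & Q ] P ↔̇ (⇑ Q →̇ P ∧̇ [ α & Q ] P))

    Uniq : ∀ α Q₁ Q₂ P →
           Axiom (⟨ α & Q₁ ∧̇ Q₂ ⟩ P ↔̇ (⟨ α & Q₁ ⟩ P ∧̇ ⟨ α & Q₂ ⟩ P))

    Cont : ∀ {n} (xs : Vec Var n) fs .(u : Unique xs) (ys : Vec Var n) e →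
           .(Unique (ys Vec.++ xs)) →
           Disjoint (toList ys) (fvRhs fs) → Disjoint (toList ys) (fvTerm e) →
           let x=y : ∀ {k} → Fml S k
               x=y = Vec.map var xs ≐* Vec.map var ys in
           Axiom (¬̇ fs ≐* Vec.replicate n (con 0ℚ) →̇ x=y →̇
                  (⟨ ode xs fs u & e >̇ con 0ℚ ⟩ ¬̇ x=y ↔̇ e >̇ con 0ℚ))

    Dadj : ∀ {n} (xs : Vec Var n) fs .(u : Unique xs) (ys : Vec Var n) .(u′ : Unique ys) Q →
           .(Unique (ys Vec.++ xs)) →
           Disjoint (toList ys) (fvRhs fs) → Disjoint (toList ys) (fv Q) →
           let σ = xs ↦* Vec.map var ys in
           Admissible σ Q →
           Axiom (⟨ ode xs fs u & Q ⟩ (Vec.map var xs ≐* Vec.map var ys) ↔̇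
                  ⟨ ode ys (Vec.map (neg ∘ bind σ) fs) u′ & subst σ Q ⟩
                    (Vec.map var ys ≐* Vec.map var xs))

    -- As in Cont, the flow must not be stationary: for f(x) = 0 the right
    -- side of the equivalence is false even if P is true.
    RI : ∀ {n} (xs : Vec Var n) fs .(u : Unique xs) (ys : Vec Var n) (P : Fml S fo) →
         .(Unique (ys Vec.++ xs)) →
         Disjoint (toList ys) (fvRhs fs) → Disjoint (toList ys) (fv P) →
         let α = ode xs fs u
             x=y : ∀ {k} → Fml S k
             x=y = Vec.map var xs ≐* Vec.map var ys in
         Axiom ([ α & true ] ¬̇ fs ≐* Vec.replicate n (con 0ℚ) →̇
                ([ α & true ] ⇑ P ↔̇
                 ∀* ys ([ α & P ∨̇ x=y ] (x=y →̇ ⇑ P ∧̇ ⟨ α & P ∨̇ x=y ⟩ ¬̇ x=y))))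

    BDG : ∀ {m n} (xs : Vec Var n) fs .(u : Unique xs) (ys : Vec Var m) gs Q P p
          .(u′ : Unique (ys Vec.++ xs)) →
          Disjoint (toList ys) (fvRhs fs) → Disjoint (toList ys) (fv Q) →
          Disjoint (toList ys) (fv P) → Disjoint (toList ys) (fvTerm p) →
          let α   = ode xs fs u
              β   = ode (ys Vec.++ xs) (gs Vec.++ fs) u′
              ‖y‖² = Vec.foldr′ _⊕_ (con 0ℚ) (Vec.map (λ y → var y ⊗ var y) ys) in
          Axiom ([ β & Q ] (‖y‖² ≤̇ p) →̇ ([ α & Q ] P ↔̇ [ β & Q ] P))

    -- The order in which the equations of a system are listed is irrelevant.
    reorder : ∀ α β Q P →
              toList (Vec.zip (ODE.vars α) (ODE.rhs α)) ↭ toList (Vec.zip (ODE.vars β) (ODE.rhs β)) →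
              Axiom ([ α & Q ] P →̇ [ β & Q ] P)

    FI : ∀ {φ} → FunctionAxiom φ → Axiom φ

  infix 3 _⊩_⊢_

  -- Γ ⊢ Δ is derivable from the sequents ⊢ P with Premise P.
  data _⊩_⊢_ (Premise : Fml S dl → Set) : List (Fml S dl) → List (Fml S dl) → Set where
    premise : ∀ {P} → Premise P → Premise ⊩ [] ⊢ P ∷ []

    ident : ∀ {Γ Δ φ} → φ ∈ Γ → φ ∈ Δ → Premise ⊩ Γ ⊢ Δ
    struct : ∀ {Γ Γ′ Δ Δ′} → Γ′ ⊆ Γ → Δ′ ⊆ Δ → Premise ⊩ Γ′ ⊢ Δ′ → Premise ⊩ Γ ⊢ Δ
    cut : ∀ {Γ Δ} φ → Premise ⊩ Γ ⊢ φ ∷ Δ → Premise ⊩ φ ∷ Γ ⊢ Δ → Premise ⊩ Γ ⊢ Δ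

    ¬L : ∀ {Γ Δ φ} → Premise ⊩ Γ ⊢ φ ∷ Δ → Premise ⊩ ¬̇ φ ∷ Γ ⊢ Δ
    ¬R : ∀ {Γ Δ φ} → Premise ⊩ φ ∷ Γ ⊢ Δ → Premise ⊩ Γ ⊢ ¬̇ φ ∷ Δ
    ∧L : ∀ {Γ Δ φ ψ} → Premise ⊩ φ ∷ ψ ∷ Γ ⊢ Δ → Premise ⊩ φ ∧̇ ψ ∷ Γ ⊢ Δ
    ∧R : ∀ {Γ Δ φ ψ} → Premise ⊩ Γ ⊢ φ ∷ Δ → Premise ⊩ Γ ⊢ ψ ∷ Δ → Premise ⊩ Γ ⊢ φ ∧̇ ψ ∷ Δ
    ∨L : ∀ {Γ Δ φ ψ} → Premise ⊩ φ ∷ Γ ⊢ Δ → Premise ⊩ ψ ∷ Γ ⊢ Δ → Premise ⊩ φ ∨̇ ψ ∷ Γ ⊢ Δ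
    ∨R : ∀ {Γ Δ φ ψ} → Premise ⊩ Γ ⊢ φ ∷ ψ ∷ Δ → Premise ⊩ Γ ⊢ φ ∨̇ ψ ∷ Δ
    →L : ∀ {Γ Δ φ ψ} → Premise ⊩ Γ ⊢ φ ∷ Δ → Premise ⊩ ψ ∷ Γ ⊢ Δ → Premise ⊩ (φ →̇ ψ) ∷ Γ ⊢ Δ
    →R : ∀ {Γ Δ φ ψ} → Premise ⊩ φ ∷ Γ ⊢ ψ ∷ Δ → Premise ⊩ Γ ⊢ (φ →̇ ψ) ∷ Δ

    ∀L : ∀ {Γ Δ x φ} e → Admissible (x ↦ e) φ →
         Premise ⊩ subst (x ↦ e) φ ∷ Γ ⊢ Δ → Premise ⊩ (∀̇ x ∙ φ) ∷ Γ ⊢ Δ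
    ∀R : ∀ {Γ Δ x φ} → x ∉ concatMap fv Γ → x ∉ concatMap fv Δ →
         Premise ⊩ Γ ⊢ φ ∷ Δ → Premise ⊩ Γ ⊢ (∀̇ x ∙ φ) ∷ Δ
    ∃L : ∀ {Γ Δ x φ} → x ∉ concatMap fv Γ → x ∉ concatMap fv Δ →
         Premise ⊩ φ ∷ Γ ⊢ Δ → Premise ⊩ (∃̇ x ∙ φ) ∷ Γ ⊢ Δ
    ∃R : ∀ {Γ Δ x φ} e → Admissible (x ↦ e) φ →
         Premise ⊩ Γ ⊢ subst (x ↦ e) φ ∷ Δ → Premise ⊩ Γ ⊢ (∃̇ x ∙ φ) ∷ Δ
    -- Instantiation up to bound renaming, which also applies to variables
    -- that are bound by ODEs in φ.
    ∀L-rename : ∀ {Γ Δ x φ} y → y ∉ fv φ →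
                Premise ⊩ rename (swap x y) φ ∷ Γ ⊢ Δ → Premise ⊩ (∀̇ x ∙ φ) ∷ Γ ⊢ Δ
    ∃R-rename : ∀ {Γ Δ x φ} y → y ∉ fv φ →
                Premise ⊩ Γ ⊢ rename (swap x y) φ ∷ Δ → Premise ⊩ Γ ⊢ (∃̇ x ∙ φ) ∷ Δ

    real  : ∀ {Γ Δ : List (Fml ⊥ fo)} → ValidSequent J⊥ Γ Δ →
            Premise ⊩ List.map lift Γ ⊢ List.map lift Δ
    axiom : ∀ {φ} → Axiom φ → Premise ⊩ [] ⊢ φ ∷ []
    G     : ∀ {Γ α Q P} → Premise ⊩ [] ⊢ P ∷ [] → Premise ⊩ Γ ⊢ [ α & Q ] P ∷ []
    dW    : ∀ {Γ α Q P} → Premise ⊩ ⇑ Q ∷ [] ⊢ P ∷ [] → Premise ⊩ Γ ⊢ [ α & Q ] P ∷ []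
    dC    : ∀ {Γ α Q P} (C : Fml S fo) →
            Premise ⊩ Γ ⊢ [ α & Q ] ⇑ C ∷ [] → Premise ⊩ Γ ⊢ [ α & Q ∧̇ C ] P ∷ [] →
            Premise ⊩ Γ ⊢ [ α & Q ] P ∷ []

  Provable : Fml S dl → Set
  Provable φ = (λ _ → ⊥) ⊩ [] ⊢ φ ∷ []

  DerivableRule : (premise conclusion : Fml S dl) → Set
  DerivableRule P C = (_≡ P) ⊩ [] ⊢ C ∷ []

-- The initial value problem x′ = f(x), x(T₀) = X with f a tuple of
-- polynomials.
record IVP : Set where
  field
    n  : ℕ
    f  : Vec (Term ⊥ (Fin (suc n))) (suc n)
    X  : Vec ℚ (suc n)
    T₀ : ℚ

module _ {S : Set} (h : IVP) where
  open IVP h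

  -- The defining formula, in the variables xs = (x₀,…,xₙ) and t.  Its free
  -- variables are x₀ and t.
  definingFormula : (xs : Vec Var (suc n)) (t : Var) → .(Unique (t ∷ xs)) → Fml S dl
  definingFormula xs t u =
    ∃* (Vec.tail xs)
       (⟨ ode (t ∷ xs) (con (ℚ.- 1ℚ) ∷ Vec.map neg fs) u & true ⟩ target ∨̇
        ⟨ ode (t ∷ xs) (con 1ℚ ∷ fs)                   u & true ⟩ target)
    where
    fs : Vec (Term S Var) (suc n)
    fs = Vec.map (bind (var ∘ lookup xs) ∘ liftTerm) f

    target : Fml S dl
    target = Vec.map var xs ≐* Vec.map con X ∧̇ var t ≐ con T₀

  -- φₕ(e₀,e₁).  The terms are not substituted for x₀ and t, because these
  -- are bound by the ODEs.
  definingFormulaAt : (xs : Vec Var (suc n)) (t : Var) → .(Unique (t ∷ xs)) →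
                      Term S Var → Term S Var → Fml S dl
  definingFormulaAt xs t u e₀ e₁ =
    ∃̇ Vec.head xs ∙ ∃̇ t ∙
      (var (Vec.head xs) ≐ e₀ ∧̇ var t ≐ e₁ ∧̇ definingFormula xs t u)

-- ∃x₀ φₕ(x₀,t), with t and x₀,…,xₙ the variables 0 and 1,…,n+1.
globalExistence : IVP → Fml ⊥ dl
globalExistence h = ∃̇ Vec.head xs ∙ definingFormula h xs 0 (Unique.tabulate⁺ toℕ-injective)
  where
  xs : Vec Var (suc (IVP.n h))
  xs = Vec.tabulate (suc ∘ toℕ)

module _ (ℝ : RealNumbers) where
  open RealNumbers ℝ
  open Semantics ℝ
  private
    module Core = Calculus ℝ J⊥ (λ _ → ⊥)

  -- Global existence is to be proved in dL without function symbols, so that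
  -- the definition is not circular.
  record Symbol : Set where
    field
      ivp     : IVP
      .global : Core.Provable (globalExistence ivp)

  -- The functions ⟦ h ⟧ˢ are uniquely determined, by uniqueness of solutions.
  record Interpretation : Set where
    field
      ⟦_⟧ˢ     : Symbol → Carrier → Carrier
      standard : (h : Symbol) → let open IVP (Symbol.ivp h) in
                 Σ (Fin (suc n) → Carrier → Carrier) λ x →
                   (∀ i → x i (fromℚ T₀) ≈ fromℚ (lookup X i)) ×
                   (∀ i t → HasDerivative (λ _ → ⊤) (x i) (⟦_⟧ J⊥ (lookup f i) (λ j → x j t)) t) ×
                   (∀ t → ⟦_⟧ˢ h t ≈ x fzero t)

  data FunctionInterpretation : Fml Symbol dl → Set where
    FI : (h : Symbol) → let ivp = Symbol.ivp h in
         ∀ e₀ e₁ (xs : Vec Var (suc (IVP.n ivp))) t .(u : Unique (t ∷ xs)) →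
         Disjoint (t ∷ toList xs) (fvTerm e₀ ++ fvTerm e₁) →
         FunctionInterpretation (e₀ ≐ fn h e₁ ↔̇ definingFormulaAt ivp xs t u e₀ e₁)

data Rel₀ : Set where
  ≥0 >0 : Rel₀

atom : ∀ {S k} → Rel₀ → Term S Var → Fml S k
atom ≥0 t = t ≥̇ con 0ℚ
atom >0 t = t >̇ con 0ℚ

data Quantifier : Set where
  all ex : Quantifier

bounded : ∀ {S k} → Quantifier → Var → Fml S k → Fml S k → Fml S k
bounded all x guard χ = ∀̇ x ∙ (guard →̇ χ)
bounded ex  x guard χ = ∃̇ x ∙ (guard ∧̇ χ)

data Clause (S : Set) : Set where
  lit  : Rel₀ → Term S Var → Clause S
  _or_ : Clause S → Clause S → Clause S

data CNF (S : Set) : Set where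
  clause : Clause S → CNF S
  _and_  : CNF S → CNF S → CNF S

-- quant q y a b χ is Q^{[a,b]}y χ; the endpoints are without function symbols.
data BoundedFml (S : Set) : Set where
  matrix : CNF S → BoundedFml S
  quant  : Quantifier → Var → (a b : Term ⊥ Var) → BoundedFml S → BoundedFml S

within : ∀ {S k} → Term S Var → Var → Term S Var → Fml S k
within a y b = a ≤̇ var y ∧̇ var y ≤̇ b

clauseFml : ∀ {S k} → Clause S → Fml S k
clauseFml (lit r t) = atom r t
clauseFml (c or d)  = clauseFml c ∨̇ clauseFml d

cnfFml : ∀ {S k} → CNF S → Fml S k
cnfFml (clause c) = clauseFml c
cnfFml (ψ and χ)  = cnfFml ψ ∧̇ cnfFml χ

fml : ∀ {S k} → BoundedFml S → Fml S k
fml (matrix ψ)        = cnfFml ψ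
fml (quant q y a b χ) = bounded q y (within (liftTerm a) y (liftTerm b)) (fml χ)

prefix : ∀ {S} → BoundedFml S → List Var
prefix (matrix _)        = []
prefix (quant _ y _ _ χ) = y ∷ prefix χ

-- The quantified variables are distinct, and the endpoints for y contain
-- neither y nor any variable quantified after it.
WellScoped : ∀ {S} → BoundedFml S → Set
WellScoped (matrix _)        = ⊤
WellScoped (quant _ y a b χ) =
  y ∉ prefix χ × Disjoint (y ∷ prefix χ) (fvTerm a ++ fvTerm b) × WellScoped χ

subterms : ∀ {S} → Term S Var → List (Term S Var)
subterms t@(var _)  = t ∷ []
subterms t@(con _)  = t ∷ []
subterms t@(s ⊕ s′) = t ∷ subterms s ++ subterms s′
subterms t@(s ⊗ s′) = t ∷ subterms s ++ subterms s′
subterms t@(fn _ s) = t ∷ subterms s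

-- The pairs (f , e) for the subterms f(e).
applications : ∀ {S} → Term S Var → List (S × Term S Var)
applications (var _)  = []
applications (con _)  = []
applications (s ⊕ t)  = applications s ++ applications t
applications (s ⊗ t)  = applications s ++ applications t
applications (fn h t) = (h , t) ∷ applications t

clauseTerms : ∀ {S} → Clause S → List (Term S Var)
clauseTerms (lit _ t) = subterms t
clauseTerms (c or d)  = clauseTerms c ++ clauseTerms d

cnfTerms : ∀ {S} → CNF S → List (Term S Var)
cnfTerms (clause c) = clauseTerms c
cnfTerms (ψ and χ)  = cnfTerms ψ ++ cnfTerms χ

terms : ∀ {S} → BoundedFml S → List (Term S Var)
terms (matrix ψ)        = cnfTerms ψ
terms (quant _ y a b χ) =
  var y ∷ subterms (liftTerm a) ++ subterms (liftTerm b) ++ terms χ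

variables : ∀ {S} → BoundedFml S → List Var
variables φ = concatMap fvTerm (terms φ)

fresh : List Var → Var
fresh vs = suc (foldr ℕ._⊔_ 0 vs)

-- Two variables that do not occur in φ.
fresh₀ fresh₁ : ∀ {S} → BoundedFml S → Var
fresh₀ φ = fresh (variables φ)
fresh₁ φ = suc (fresh₀ φ)

functionTerms : ∀ {S} → BoundedFml S → List (S × Term S Var)
functionTerms φ = concatMap applications (terms φ)

bounds : ∀ {S} → BoundedFml S → List (Var × Term ⊥ Var × Term ⊥ Var)
bounds (matrix _)        = []
bounds (quant _ y a b χ) = (y , a , b) ∷ bounds χ

record IQ : Set where
  field
    lower upper : ℚ
    lower≤upper : lower ℚ.≤ upper

_∈̇_ : ∀ {S k} → Term S Var → IQ → Fml S k
t ∈̇ K = con (IQ.lower K) ≤̇ t ∧̇ t ≤̇ con (IQ.upper K)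

infix 9 _∈̇_

∀[_∈_]_ : ∀ {S k} → Var → IQ → Fml S k → Fml S k
∀[ x ∈ K ] χ = bounded all x (var x ∈̇ K) χ

infixr 4 ∀[_∈_]_

-- The conditions on an ε-enclosure, as formulas: for an enclosure they are
-- valid, for a provable enclosure they are provable.  I is a function on all
-- terms, but only its values on the terms of φ are constrained.
data EnclosureCondition {S : Set} (ε : ℚ) (φ : BoundedFml S) (I : Term S Var → IQ) :
                        Fml S dl → Set where
  constant : ∀ {q} → con q ∈ terms φ → EnclosureCondition ε φ I (con q ∈̇ I (con q))

  bound : ∀ {y a b} → (y , a , b) ∈ bounds φ →
          let x = fresh₀ φ in
          EnclosureCondition ε φ I
            (∀̇ x ∙ (var x ∈̇ I (liftTerm a) ∨̇ var x ∈̇ I (liftTerm b) →̇ var x ∈̇ I (var y)))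

  sum : ∀ {s t} → s ⊕ t ∈ terms φ →
        let x = fresh₀ φ
            y = fresh₁ φ in
        EnclosureCondition ε φ I
          (∀[ x ∈ I s ] ∀[ y ∈ I t ] (var x ⊕ var y) ∈̇ I (s ⊕ t))

  product : ∀ {s t} → s ⊗ t ∈ terms φ →
            let x = fresh₀ φ
                y = fresh₁ φ in
            EnclosureCondition ε φ I
              (∀[ x ∈ I s ] ∀[ y ∈ I t ] (var x ⊗ var y) ∈̇ I (s ⊗ t))

  application : ∀ {h e} → fn h e ∈ terms φ →
                let x = fresh₀ φ
                    r = fresh₁ φ in
                EnclosureCondition ε φ I
                  (∀[ x ∈ I e ] bounded all r (within (con (ℚ.- ε)) r (con ε))
                                 ((fn h (var x) ⊕ var r) ∈̇ I (fn h e)))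

module _ (ℝ : RealNumbers) where
  open RealNumbers ℝ
  open Semantics ℝ

  -- A formula in the variables 0 (argument) and 1 (value) that defines a
  -- function.
  record DefinableFunction : Set where
    field
      formula    : Fml ⊥ fo
      scoped     : fv formula ⊆ 0 ∷ 1 ∷ []
      functional : ∀ ω → ∃! _≈_ λ b → _⊨_ J⊥ (ω [ 1 ≔ b ]) formula

  -- The formula body(F(e)), written out as ∃s ∃z (s = e ∧ F(s,z) ∧ body(z)).
  -- The shift takes all variables of the defining formula to N, N+1, …; the
  -- variables of e and body must be below N.
  withValue : ∀ {S k} → ℕ → DefinableFunction → Term S Var → (Var → Fml S k) → Fml S k
  withValue N F e body =
    ∃̇ N ∙ ∃̇ suc N ∙
      (var N ≐ e ∧̇ lift (rename (shift N) (DefinableFunction.formula F)) ∧̇ body (suc N))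

  Approximation : Set
  Approximation = Symbol ℝ → Term (Symbol ℝ) Var → DefinableFunction

  -- The formulas 𝒜^∀_F(t ⪰ 0, δ) (q = all) and 𝒜^∃_F(t ⪰ 0, δ) (q = ex).
  -- In replace, the variable w takes the place of all occurrences of f(e),
  -- where e is without function symbols, and t is the resulting term.
  -- A fresh variable is one not in used.
  data AtomPerturbation (q : Quantifier) (δ : ℚ) (r : Rel₀) :
         List Var → Approximation → Term (Symbol ℝ) Var → Fml ⊥ fo → Set where
    done : ∀ {used F} t → AtomPerturbation q δ r used F (liftTerm t) (atom r t)
    replace : ∀ {used F χ} h (e : Term ⊥ Var) w t →
              let fe   = fn h (liftTerm e)
                  back = bind (w ↦ fe)
                  N    = fresh (w ∷ used) in
              w ∉ used → w ∈ fvTerm t → (h , liftTerm e) ∉ applications t →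
              AtomPerturbation q δ r (w ∷ used) (λ g s → F g (back s)) t χ →
              AtomPerturbation q δ r used F (back t)
                (bounded q w (withValue N (F h (liftTerm e)) e λ z →
                               within (var z ⊕ con (ℚ.- δ)) w (var z ⊕ con δ))
                         χ)

  module _ (q : Quantifier) (δ : ℚ) (F : Approximation) (used : List Var) where

    data ClausePerturbation : Clause (Symbol ℝ) → Fml ⊥ fo → Set where
      lit  : ∀ {r t χ} → AtomPerturbation q δ r used F t χ → ClausePerturbation (lit r t) χ
      _or_ : ∀ {c d χ χ′} → ClausePerturbation c χ → ClausePerturbation d χ′ →
             ClausePerturbation (c or d) (χ ∨̇ χ′)

    data CNFPerturbation : CNF (Symbol ℝ) → Fml ⊥ fo → Set where
      clause : ∀ {c χ} → ClausePerturbation c χ → CNFPerturbation (clause c) χ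
      _and_  : ∀ {ψ ψ′ χ χ′} → CNFPerturbation ψ χ → CNFPerturbation ψ′ χ′ →
               CNFPerturbation (ψ and ψ′) (χ ∧̇ χ′)

    data BoundedPerturbation : BoundedFml (Symbol ℝ) → Fml ⊥ fo → Set where
      matrix : ∀ {ψ χ} → CNFPerturbation ψ χ → BoundedPerturbation (matrix ψ) χ
      quant  : ∀ {q′ y a b φ χ} → BoundedPerturbation φ χ →
               BoundedPerturbation (quant q′ y a b φ) (bounded q′ y (within a y b) χ)

  -- χ is 𝒜^∀_F(φ,δ) (q = all) or 𝒜^∃_F(φ,δ) (q = ex).  These formulas are
  -- determined up to the order in which function applications are replaced
  -- and the choice of fresh variables.
  Perturbation : Quantifier → ℚ → Approximation → BoundedFml (Symbol ℝ) → Fml ⊥ fo → Set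
  Perturbation q δ F φ = BoundedPerturbation q δ F (variables φ) φ

module dL (ℝ : RealNumbers) (J : Interpretation ℝ) where
  open Interpretation J
  open Semantics ℝ using (Valid)
  open Calculus ℝ ⟦_⟧ˢ (FunctionInterpretation ℝ) public using (Provable; DerivableRule)

  SoundRule : (premise conclusion : Fml (Symbol ℝ) dl) → Set
  SoundRule = Semantics.SoundRule ℝ ⟦_⟧ˢ

  Enclosure : ℚ → BoundedFml (Symbol ℝ) → (Term (Symbol ℝ) Var → IQ) → Set
  Enclosure ε φ I = ∀ {χ} → EnclosureCondition ε φ I χ → Valid ⟦_⟧ˢ χ

  ProvableEnclosure : ℚ → BoundedFml (Symbol ℝ) → (Term (Symbol ℝ) Var → IQ) → Set
  ProvableEnclosure ε φ I = ∀ {χ} → EnclosureCondition ε φ I χ → Provable χ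

  -- ⋀ ∀s∈I_e |F(s) - f(s)| ≤ δ over all f(e) in φ
  approximationPremise : BoundedFml (Symbol ℝ) → Approximation ℝ → ℚ →
                         (Term (Symbol ℝ) Var → IQ) → Fml (Symbol ℝ) dl
  approximationPremise φ F δ I = ⋀ (List.map close (functionTerms φ))
    where
    close : Symbol ℝ × Term (Symbol ℝ) Var → Fml (Symbol ℝ) dl
    close (h , e) =
      let s = fresh₀ φ in
      ∀[ s ∈ I e ] withValue ℝ (fresh₁ φ) (F h e) (var s) λ z →
        let d = var z ⊕ neg (fn h (var s)) in con (ℚ.- δ) ≤̇ d ∧̇ d ≤̇ con δ

  closure : List Var → (Term (Symbol ℝ) Var → IQ) → Fml (Symbol ℝ) dl → Fml (Symbol ℝ) dl
  closure xs I χ = foldr (λ x → ∀[ x ∈ I (var x) ]_) χ xs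

{-# OPTIONS --safe #-}

-- Among the values of the variable w that a perturbation puts for f(e), only
-- w = f(e) matters.  From e ∈ I_e it follows that f(e) ∈ I_{f(e)} and that
-- f(e) is within δ of F(e), so this value is admitted by the bounded
-- quantifier; it turns the perturbed atom into the original one, which is
-- therefore implied by ∀w and implies ∃w.  Conjunction, disjunction and
-- bounded quantifiers are monotone, and the enclosure keeps each quantified
-- variable y in I_y.

module Submission where

open import Defs
open import Algebra.Bundles using (CommutativeRing)
open import Algebra.Morphism.Structures using (IsRingHomomorphism)
import Algebra.Properties.Group as GroupProperties
import Algebra.Properties.Ring as RingProperties
open import Axiom.ExcludedMiddle using (ExcludedMiddle)
open import Data.Empty using (⊥)
open import Data.List.Base as List using (List; []; _∷_; _++_; concatMap; foldr)
open import Data.List.Membership.Propositional using (_∈_; _∉_; find; lose)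
open import Data.List.Membership.Propositional.Properties
  using (∈-++⁺ˡ; ∈-++⁺ʳ; ∈-++⁻; ∈-filter⁺; ∈-filter⁻;
         ∈-concatMap⁺; ∈-concatMap⁻; ∈-map⁺; ∈-map⁻)
import Data.List.Properties as List
open import Data.List.Relation.Binary.Subset.Propositional using (_⊆_)
open import Data.List.Relation.Unary.All as All using (All; []; _∷_)
open import Data.List.Relation.Unary.Any using (here; there)
open import Data.List.Relation.Unary.Unique.Propositional using (Unique; _∷_)
open import Data.Nat.Base as ℕ using (ℕ; suc; s≤s)
import Data.Nat.Properties as ℕ
open import Data.Product using (∃; _×_; _,_; proj₁; proj₂)
open import Data.Product.Function.NonDependent.Propositional using (_×-⇔_)
open import Data.Rational using (ℚ; 0ℚ; ½; 1ℚ; _<_)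
import Data.Rational.Base as ℚ
open import Data.Sum.Base as Sum using (_⊎_; inj₁; inj₂; [_,_]′)
open import Data.Sum.Function.Propositional using (_⊎-⇔_)
open import Data.Unit.Base using (tt)
open import Data.Vec.Base as Vec using (Vec; []; _∷_)
open import Function.Base using (_∘_; id)
open import Function.Bundles using (_⇔_; mk⇔; _↣_; Equivalence; Injection)
open import Function.Related.TypeIsomorphisms using (→-cong-⇔; ¬-cong-⇔)
open import Level using (0ℓ)
open import Relation.Binary.PropositionalEquality
  using (_≡_; _≢_; refl; sym; trans; cong; cong₂)
  renaming (subst to transport)
open import Relation.Binary.Structures using (IsTotalOrder)
open import Relation.Nullary using (¬_; yes; no; contradiction)
open import Relation.Nullary.Decidable using (¬?)

-- Substitution and free variables

-- In the calculus the obstacle is that arithmetic enters only through `real`, for sequents without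
-- function symbols, and that `subst` never renames bound variables. So each `f(e)` is named by a
-- variable, Leibniz rewriting moves facts to that name, and only then is arithmetic applied. Nested
-- applications are removed from the inside: the argument of a replaced `f(e)` is free of function
-- symbols, because earlier replacements left variables in it. The variable `w` put for `f(e)`
-- inherits the interval of `f(e)`, so interval arithmetic also encloses the argument of the next
-- outer application. To keep `F` and `I` meaningful after a replacement, both are precomposed with
-- the substitution that puts `f(e)` back. Interval facts about terms without function symbols stay
-- semantic even for derivability, since `real` turns them into derivations. Only the facts about
-- `f` itself, enclosure and approximation, have to be derived.

module _ {A : Set} (f : Var → A) (x : Var) (a : A) where

  ≔-same : (f [ x ≔ a ]) x ≡ a
  ≔-same with x ℕ.≟ x
  ... | yes _   = refl
  ... | no  x≢x = contradiction refl x≢x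

  ≔-other : ∀ {v} → v ≢ x → (f [ x ≔ a ]) v ≡ f v
  ≔-other {v} v≢x with v ℕ.≟ x
  ... | yes v≡x = contradiction v≡x v≢x
  ... | no  _   = refl

remove⁺ : ∀ {x v vs} → v ∈ vs → v ≢ x → v ∈ remove x vs
remove⁺ {x} = ∈-filter⁺ (λ v → ¬? (v ℕ.≟ x))

remove⁻ : ∀ {x v vs} → v ∈ remove x vs → v ∈ vs × v ≢ x
remove⁻ {x} = ∈-filter⁻ (λ v → ¬? (v ℕ.≟ x))

<fresh : ∀ {v} vs → v ∈ vs → v ℕ.< fresh vs
<fresh (v ∷ vs) (here refl) = s≤s (ℕ.m≤m⊔n v _)
<fresh (u ∷ vs) (there v∈)  = ℕ.≤-trans (<fresh vs v∈) (s≤s (ℕ.m≤n⊔m u _))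

_Fixes_ : ∀ {S} → Subst S → List Var → Set
σ Fixes vs = ∀ {v} → v ∈ vs → σ v ≡ var v

fixes-remove : ∀ {S} {σ : Subst S} {x} vs → σ Fixes remove x vs → (σ except x) Fixes vs
fixes-remove {x = x} vs fix {v} v∈ with v ℕ.≟ x
... | yes refl = refl
... | no  v≢x  = fix (remove⁺ v∈ v≢x)

↦-self-fixes : ∀ {S} x vs → (_↦_ {S} x (var x)) Fixes vs
↦-self-fixes x vs {v} _ with v ℕ.≟ x
... | yes refl = refl
... | no  _    = refl

↦-fixes : ∀ {S} {x} {e : Term S Var} vs → x ∉ vs → (x ↦ e) Fixes vs
↦-fixes {x = x} {e} vs x∉ {v} v∈ = ≔-other var x e λ {refl → x∉ v∈}

module _ {S : Set} where

  bind-fixed : ∀ {σ : Subst S} t → σ Fixes fvTerm t → bind σ t ≡ t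
  bind-fixed (var x)  fix = fix (here refl)
  bind-fixed (con q)  fix = refl
  bind-fixed (s ⊕ t)  fix =
    cong₂ _⊕_ (bind-fixed s (fix ∘ ∈-++⁺ˡ)) (bind-fixed t (fix ∘ ∈-++⁺ʳ (fvTerm s)))
  bind-fixed (s ⊗ t)  fix =
    cong₂ _⊗_ (bind-fixed s (fix ∘ ∈-++⁺ˡ)) (bind-fixed t (fix ∘ ∈-++⁺ʳ (fvTerm s)))
  bind-fixed (fn h t) fix = cong (fn h) (bind-fixed t fix)

  bindVec-fixed : ∀ {n} {σ : Subst S} (es : Vec (Term S Var) n) →
                  σ Fixes fvRhs es → Vec.map (bind σ) es ≡ es
  bindVec-fixed []       fix = refl
  bindVec-fixed (e ∷ es) fix =
    cong₂ _∷_ (bind-fixed e (fix ∘ ∈-++⁺ˡ)) (bindVec-fixed es (fix ∘ ∈-++⁺ʳ (fvTerm e)))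

  substODE-fixed : ∀ {σ : Subst S} α → σ Fixes fvRhs (ODE.rhs α) → substODE σ α ≡ α
  substODE-fixed (ode xs es u) fix = cong (λ es → ode xs es u) (bindVec-fixed es fix)

  private
    fvQ⊆ : ∀ α (Q : Fml S fo) P → fv Q ⊆ fvModal α Q P
    fvQ⊆ α Q P = ∈-++⁺ʳ (boundVars α) ∘ ∈-++⁺ʳ (fvRhs (ODE.rhs α)) ∘ ∈-++⁺ˡ

    fvP⊆ : ∀ α (Q : Fml S fo) P → fv P ⊆ fvModal α Q P
    fvP⊆ α Q P = ∈-++⁺ʳ (boundVars α) ∘ ∈-++⁺ʳ (fvRhs (ODE.rhs α)) ∘ ∈-++⁺ʳ (fv Q)

  subst-fixed : ∀ {k} {σ : Subst S} (φ : Fml S k) → σ Fixes fv φ → subst σ φ ≡ φ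
  substModal-fixed : ∀ {σ : Subst S} (M : ODE S → Fml S fo → Fml S dl → Fml S dl) α Q P →
                     σ Fixes fvModal α Q P →
                     M (substODE σ α) (subst σ Q) (subst σ P) ≡ M α Q P

  subst-fixed (cmp c s t)   fix =
    cong₂ (cmp c) (bind-fixed s (fix ∘ ∈-++⁺ˡ)) (bind-fixed t (fix ∘ ∈-++⁺ʳ (fvTerm s)))
  subst-fixed (¬̇ φ)         fix = cong ¬̇_ (subst-fixed φ fix)
  subst-fixed (φ ∧̇ ψ)       fix =
    cong₂ _∧̇_ (subst-fixed φ (fix ∘ ∈-++⁺ˡ)) (subst-fixed ψ (fix ∘ ∈-++⁺ʳ (fv φ)))
  subst-fixed (φ ∨̇ ψ)       fix =
    cong₂ _∨̇_ (subst-fixed φ (fix ∘ ∈-++⁺ˡ)) (subst-fixed ψ (fix ∘ ∈-++⁺ʳ (fv φ)))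
  subst-fixed (φ →̇ ψ)       fix =
    cong₂ _→̇_ (subst-fixed φ (fix ∘ ∈-++⁺ˡ)) (subst-fixed ψ (fix ∘ ∈-++⁺ʳ (fv φ)))
  subst-fixed (∀̇ x ∙ φ)     fix = cong (∀̇ x ∙_) (subst-fixed φ (fixes-remove (fv φ) fix))
  subst-fixed (∃̇ x ∙ φ)     fix = cong (∃̇ x ∙_) (subst-fixed φ (fixes-remove (fv φ) fix))
  subst-fixed ([ α & Q ] P) fix = substModal-fixed [_&_]_ α Q P fix
  subst-fixed (⟨ α & Q ⟩ P) fix = substModal-fixed ⟨_&_⟩_ α Q P fix

  substModal-fixed {σ} M α Q P fix
    rewrite substODE-fixed {σ} α (fix ∘ ∈-++⁺ʳ (boundVars α) ∘ ∈-++⁺ˡ)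
          | subst-fixed {σ = σ} Q (fix ∘ fvQ⊆ α Q P)
          | subst-fixed {σ = σ} P (fix ∘ fvP⊆ α Q P) = refl

  admissible-fixed : ∀ {k} {σ : Subst S} (φ : Fml S k) → σ Fixes fv φ → Admissible σ φ
  admissibleBinder-fixed : ∀ {k} {σ : Subst S} x (φ : Fml S k) →
                           σ Fixes remove x (fv φ) → AdmissibleBinder σ x φ
  admissibleModal-fixed : ∀ {σ : Subst S} α Q P →
                          σ Fixes fvModal α Q P → AdmissibleModal σ α Q P

  admissible-fixed (cmp _ _ _)   fix = tt
  admissible-fixed (¬̇ φ)         fix = admissible-fixed φ fix
  admissible-fixed (φ ∧̇ ψ)       fix =
    admissible-fixed φ (fix ∘ ∈-++⁺ˡ) , admissible-fixed ψ (fix ∘ ∈-++⁺ʳ (fv φ))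
  admissible-fixed (φ ∨̇ ψ)       fix =
    admissible-fixed φ (fix ∘ ∈-++⁺ˡ) , admissible-fixed ψ (fix ∘ ∈-++⁺ʳ (fv φ))
  admissible-fixed (φ →̇ ψ)       fix =
    admissible-fixed φ (fix ∘ ∈-++⁺ˡ) , admissible-fixed ψ (fix ∘ ∈-++⁺ʳ (fv φ))
  admissible-fixed (∀̇ x ∙ φ)     fix = admissibleBinder-fixed x φ fix
  admissible-fixed (∃̇ x ∙ φ)     fix = admissibleBinder-fixed x φ fix
  admissible-fixed ([ α & Q ] P) fix = admissibleModal-fixed α Q P fix
  admissible-fixed (⟨ α & Q ⟩ P) fix = admissibleModal-fixed α Q P fix

  admissibleBinder-fixed {σ = σ} x φ fix = avoids , admissible-fixed φ (fixes-remove (fv φ) fix)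
    where
    avoids : ∀ {v} → v ∈ fv φ → v ≢ x → x ∉ fvTerm (σ v)
    avoids v∈ v≢x x∈ rewrite fix (remove⁺ v∈ v≢x) with here refl ← x∈ = v≢x refl

  admissibleModal-fixed {σ} α Q P fix =
      (λ v∈ → fix (∈-++⁺ˡ v∈))
    , avoids
    , admissible-fixed Q (fix ∘ fvQ⊆ α Q P)
    , admissible-fixed P (fix ∘ fvP⊆ α Q P)
    where
    avoids : ∀ {v} → v ∈ fvModal α Q P → v ∉ boundVars α →
             ∀ {x} → ¬ (x ∈ boundVars α × x ∈ fvTerm (σ v))
    avoids v∈ v∉ (x∈ , x∈σv) rewrite fix v∈ with here refl ← x∈σv = v∉ x∈

  fvTerm-bind⁺ : ∀ {V W} {σ : V → Term S W} t {u v} →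
                 u ∈ fvTerm t → v ∈ fvTerm (σ u) → v ∈ fvTerm (bind σ t)
  fvTerm-bind⁺ (var x)  (here refl) v∈ = v∈
  fvTerm-bind⁺ {σ = σ} (s ⊕ t) u∈ v∈ with ∈-++⁻ (fvTerm s) u∈
  ... | inj₁ u∈s = ∈-++⁺ˡ (fvTerm-bind⁺ s u∈s v∈)
  ... | inj₂ u∈t = ∈-++⁺ʳ (fvTerm (bind σ s)) (fvTerm-bind⁺ t u∈t v∈)
  fvTerm-bind⁺ {σ = σ} (s ⊗ t) u∈ v∈ with ∈-++⁻ (fvTerm s) u∈
  ... | inj₁ u∈s = ∈-++⁺ˡ (fvTerm-bind⁺ s u∈s v∈)
  ... | inj₂ u∈t = ∈-++⁺ʳ (fvTerm (bind σ s)) (fvTerm-bind⁺ t u∈t v∈)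
  fvTerm-bind⁺ (fn h t) u∈ v∈ = fvTerm-bind⁺ t u∈ v∈

  fvTerm-bind⁻ : ∀ {V W} {σ : V → Term S W} t {v} →
                 v ∈ fvTerm (bind σ t) → ∃ λ u → u ∈ fvTerm t × v ∈ fvTerm (σ u)
  fvTerm-bind⁻ (var x)  v∈ = x , here refl , v∈
  fvTerm-bind⁻ {σ = σ} (s ⊕ t) v∈ with ∈-++⁻ (fvTerm (bind σ s)) v∈
  ... | inj₁ v∈s = let u , u∈ , v∈σu = fvTerm-bind⁻ s v∈s in u , ∈-++⁺ˡ u∈ , v∈σu
  ... | inj₂ v∈t = let u , u∈ , v∈σu = fvTerm-bind⁻ t v∈t in u , ∈-++⁺ʳ (fvTerm s) u∈ , v∈σu
  fvTerm-bind⁻ {σ = σ} (s ⊗ t) v∈ with ∈-++⁻ (fvTerm (bind σ s)) v∈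
  ... | inj₁ v∈s = let u , u∈ , v∈σu = fvTerm-bind⁻ s v∈s in u , ∈-++⁺ˡ u∈ , v∈σu
  ... | inj₂ v∈t = let u , u∈ , v∈σu = fvTerm-bind⁻ t v∈t in u , ∈-++⁺ʳ (fvTerm s) u∈ , v∈σu
  fvTerm-bind⁻ (fn h t) v∈ = fvTerm-bind⁻ t v∈

  t∈subterms : ∀ (t : Term S Var) → t ∈ subterms t
  t∈subterms (var x)  = here refl
  t∈subterms (con q)  = here refl
  t∈subterms (s ⊕ t)  = here refl
  t∈subterms (s ⊗ t)  = here refl
  t∈subterms (fn h t) = here refl

  fvTerm⇒subterms : ∀ t {v} → v ∈ fvTerm t → _∈_ {A = Term S Var} (var v) (subterms t)
  fvTerm⇒subterms (var x)  (here refl) = here refl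
  fvTerm⇒subterms (s ⊕ t)  v∈ with ∈-++⁻ (fvTerm s) v∈
  ... | inj₁ v∈s = there (∈-++⁺ˡ (fvTerm⇒subterms s v∈s))
  ... | inj₂ v∈t = there (∈-++⁺ʳ (subterms s) (fvTerm⇒subterms t v∈t))
  fvTerm⇒subterms (s ⊗ t)  v∈ with ∈-++⁻ (fvTerm s) v∈
  ... | inj₁ v∈s = there (∈-++⁺ˡ (fvTerm⇒subterms s v∈s))
  ... | inj₂ v∈t = there (∈-++⁺ʳ (subterms s) (fvTerm⇒subterms t v∈t))
  fvTerm⇒subterms (fn h t) v∈ = there (fvTerm⇒subterms t v∈)

  -- With `σ = w ↦ f(e)` and `w` occurring in `t`, this makes `f(e)` and all its subterms subject to
  -- the hypotheses on the restored atom.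
  subterms-image : ∀ {σ : Subst S} t {u} → u ∈ fvTerm t → subterms (σ u) ⊆ subterms (bind σ t)
  subterms-image (var x)  (here refl) s∈ = s∈
  subterms-image {σ} (s ⊕ t) u∈ with ∈-++⁻ (fvTerm s) u∈
  ... | inj₁ u∈s = there ∘ ∈-++⁺ˡ ∘ subterms-image s u∈s
  ... | inj₂ u∈t = there ∘ ∈-++⁺ʳ (subterms (bind σ s)) ∘ subterms-image t u∈t
  subterms-image {σ} (s ⊗ t) u∈ with ∈-++⁻ (fvTerm s) u∈
  ... | inj₁ u∈s = there ∘ ∈-++⁺ˡ ∘ subterms-image s u∈s
  ... | inj₂ u∈t = there ∘ ∈-++⁺ʳ (subterms (bind σ s)) ∘ subterms-image t u∈t
  subterms-image (fn h t) u∈ = there ∘ subterms-image t u∈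

  -- Passes the hypotheses on the restored atom down to the atom with `w` in place of `f(e)`.
  subterms-bind : ∀ {σ : Subst S} t {s} → s ∈ subterms t → bind σ s ∈ subterms (bind σ t)
  subterms-bind {σ} (var x) (here refl) = t∈subterms (σ x)
  subterms-bind (con q)  (here refl) = here refl
  subterms-bind (t ⊕ t′) (here refl) = here refl
  subterms-bind {σ} (t ⊕ t′) (there s∈) with ∈-++⁻ (subterms t) s∈
  ... | inj₁ s∈t = there (∈-++⁺ˡ (subterms-bind t s∈t))
  ... | inj₂ s∈t′ = there (∈-++⁺ʳ (subterms (bind σ t)) (subterms-bind t′ s∈t′))
  subterms-bind (t ⊗ t′) (here refl) = here refl
  subterms-bind {σ} (t ⊗ t′) (there s∈) with ∈-++⁻ (subterms t) s∈
  ... | inj₁ s∈t = there (∈-++⁺ˡ (subterms-bind t s∈t))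
  ... | inj₂ s∈t′ = there (∈-++⁺ʳ (subterms (bind σ t)) (subterms-bind t′ s∈t′))
  subterms-bind (fn h t) (here refl) = here refl
  subterms-bind (fn h t) (there s∈)  = there (subterms-bind t s∈)

  fvTerm-lift : ∀ {V} (t : Term ⊥ V) → fvTerm (liftTerm {S} t) ≡ fvTerm t
  fvTerm-lift (var x) = refl
  fvTerm-lift (con q) = refl
  fvTerm-lift (s ⊕ t) = cong₂ _++_ (fvTerm-lift s) (fvTerm-lift t)
  fvTerm-lift (s ⊗ t) = cong₂ _++_ (fvTerm-lift s) (fvTerm-lift t)

  fv-lift : ∀ {k} (φ : Fml ⊥ fo) → fv (lift {S} {k} φ) ≡ fv φ
  fv-lift (cmp c s t) = cong₂ _++_ (fvTerm-lift s) (fvTerm-lift t)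
  fv-lift {k} (¬̇ φ)   = fv-lift {k} φ
  fv-lift {k} (φ ∧̇ ψ) = cong₂ _++_ (fv-lift {k} φ) (fv-lift {k} ψ)
  fv-lift {k} (φ ∨̇ ψ) = cong₂ _++_ (fv-lift {k} φ) (fv-lift {k} ψ)
  fv-lift {k} (φ →̇ ψ) = cong₂ _++_ (fv-lift {k} φ) (fv-lift {k} ψ)
  fv-lift {k} (∀̇ x ∙ φ) = cong (remove x) (fv-lift {k} φ)
  fv-lift {k} (∃̇ x ∙ φ) = cong (remove x) (fv-lift {k} φ)

module _ {S : Set} (ρ : Var ↣ Var) where
  private
    r : Var → Var
    r = Injection.to ρ

    fvTerm-rename : ∀ (t : Term S Var) {v} → v ∈ fvTerm (renameTerm ρ t) →
                    ∃ λ u → u ∈ fvTerm t × v ≡ r u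
    fvTerm-rename t v∈ with u , u∈ , here v≡ ← fvTerm-bind⁻ t v∈ = u , u∈ , v≡

  fv-rename : ∀ (φ : Fml S fo) {v} → v ∈ fv (rename ρ φ) → ∃ λ u → u ∈ fv φ × v ≡ r u
  fv-rename-++ : ∀ (φ ψ : Fml S fo) {v} → v ∈ fv (rename ρ φ) ++ fv (rename ρ ψ) →
                 ∃ λ u → u ∈ fv φ ++ fv ψ × v ≡ r u
  fv-rename-binder : ∀ x (φ : Fml S fo) {v} → v ∈ remove (r x) (fv (rename ρ φ)) →
                     ∃ λ u → u ∈ remove x (fv φ) × v ≡ r u

  fv-rename (cmp c s t) v∈ with ∈-++⁻ (fvTerm (renameTerm ρ s)) v∈
  ... | inj₁ v∈s = let u , u∈ , v≡ = fvTerm-rename s v∈s in u , ∈-++⁺ˡ u∈ , v≡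
  ... | inj₂ v∈t = let u , u∈ , v≡ = fvTerm-rename t v∈t in u , ∈-++⁺ʳ (fvTerm s) u∈ , v≡
  fv-rename (¬̇ φ)     v∈ = fv-rename φ v∈
  fv-rename (φ ∧̇ ψ)   v∈ = fv-rename-++ φ ψ v∈
  fv-rename (φ ∨̇ ψ)   v∈ = fv-rename-++ φ ψ v∈
  fv-rename (φ →̇ ψ)   v∈ = fv-rename-++ φ ψ v∈
  fv-rename (∀̇ x ∙ φ) v∈ = fv-rename-binder x φ v∈
  fv-rename (∃̇ x ∙ φ) v∈ = fv-rename-binder x φ v∈

  fv-rename-++ φ ψ v∈ with ∈-++⁻ (fv (rename ρ φ)) v∈
  ... | inj₁ v∈φ = let u , u∈ , v≡ = fv-rename φ v∈φ in u , ∈-++⁺ˡ u∈ , v≡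
  ... | inj₂ v∈ψ = let u , u∈ , v≡ = fv-rename ψ v∈ψ in u , ∈-++⁺ʳ (fv φ) u∈ , v≡

  fv-rename-binder x φ v∈ with remove⁻ {vs = fv (rename ρ φ)} v∈
  ... | v∈φ , v≢rx with fv-rename φ v∈φ
  ...   | u , u∈ , refl = u , remove⁺ u∈ (v≢rx ∘ cong r) , refl

-- Semantics

module RealLemmas (ℝ : RealNumbers) where
  open RealNumbers ℝ
  open Semantics ℝ
  open CommutativeRing commutativeRing public
    using (ring; +-group; setoid; reflexive; +-cong; +-congˡ; +-congʳ; +-assoc; +-comm;
           +-identityˡ; +-identityʳ; *-cong; *-congʳ; -‿cong; -‿inverseʳ)
    renaming (refl to ≈-refl; sym to ≈-sym; trans to ≈-trans)
  open IsTotalOrder isTotalOrder public using (≤-respˡ-≈; ≤-respʳ-≈)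
    renaming (refl to ≤-refl; trans to ≤-trans)
  open IsRingHomomorphism fromℚ-isRingHomomorphism public using (-‿homo; 0#-homo; 1#-homo)
  open GroupProperties +-group public using (//-rightDividesˡ; //-rightDividesʳ)
  open RingProperties ring public using (-1*x≈-x; -‿involutive)
  open import Relation.Binary.Reasoning.Setoid setoid

  _∈ᴵ_ : Carrier → IQ → Set
  a ∈ᴵ K = fromℚ (IQ.lower K) ≤ a × a ≤ fromℚ (IQ.upper K)

  infix 4 _∈ᴵ_

  ∈ᴵ-resp : ∀ {a b K} → a ≈ b → a ∈ᴵ K → b ∈ᴵ K
  ∈ᴵ-resp a≈b (l , u) = ≤-respʳ-≈ a≈b l , ≤-respˡ-≈ a≈b u

  ∈ᴵ-convex : ∀ {a b y K} → a ∈ᴵ K → b ∈ᴵ K → a ≤ y → y ≤ b → y ∈ᴵ K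
  ∈ᴵ-convex (l , _) (_ , u) a≤y y≤b = ≤-trans l a≤y , ≤-trans y≤b u

  -- If `1 ≤ 0`, then `- 1` is nonnegative, and so is its square `1`.
  0≤1 : 0# ≤ 1#
  0≤1 with total 0# 1#
  ... | inj₁ 0≤1 = 0≤1
  ... | inj₂ 1≤0 = ≤-respʳ-≈ [-1]²≈1 (*-nonNeg 0≤-1 0≤-1)
    where
    0≤-1 : 0# ≤ - 1#
    0≤-1 = ≤-respˡ-≈ (-‿inverseʳ 1#) (≤-respʳ-≈ (+-identityˡ (- 1#)) (+-monoˡ-≤ (- 1#) 1≤0))

    [-1]²≈1 : - 1# * - 1# ≈ 1#
    [-1]²≈1 = ≈-trans (-1*x≈-x (- 1#)) (-‿involutive 1#)

  -- Admits the remainder `0` in the 1-enclosure condition for applications, which then says that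
  -- the value itself lies in its interval.
  0∈[-1,1] : fromℚ (ℚ.- 1ℚ) ≤ fromℚ 0ℚ × fromℚ 0ℚ ≤ fromℚ 1ℚ
  0∈[-1,1] =
      ≤-respˡ-≈ (≈-trans (+-identityˡ _) (≈-sym (≈-trans (-‿homo 1ℚ) (-‿cong 1#-homo))))
        (≤-respʳ-≈ (≈-trans (-‿inverseʳ 1#) (≈-sym 0#-homo)) (+-monoˡ-≤ (- 1#) 0≤1))
    , ≤-respˡ-≈ (≈-sym 0#-homo) (≤-respʳ-≈ (≈-sym 1#-homo) 0≤1)

  -- The premise bounds the difference of the approximation `b` and the value `u`, whereas the
  -- perturbation bounds `u` around `b`. Adding `u - δ` to the upper bound gives the lower one, and
  -- adding `u + δ` to the lower bound gives the upper one.
  difference-bounds : ∀ δ {b u} → let d = b + fromℚ (ℚ.- 1ℚ) * u in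
                      fromℚ (ℚ.- δ) ≤ d → d ≤ fromℚ δ → b + fromℚ (ℚ.- δ) ≤ u × u ≤ b + fromℚ δ
  difference-bounds δ {b} {u} lower upper =
      ≤-respˡ-≈ (shift-by (fromℚ (ℚ.- δ)))
        (≤-respʳ-≈ (begin
          fromℚ δ + (u + fromℚ (ℚ.- δ)) ≈⟨ +-comm _ _ ⟩
          u + fromℚ (ℚ.- δ) + fromℚ δ   ≈⟨ +-congʳ (+-congˡ (-‿homo δ)) ⟩
          u + - fromℚ δ + fromℚ δ       ≈⟨ //-rightDividesˡ (fromℚ δ) u ⟩
          u                             ∎) (+-monoˡ-≤ _ upper))
    , ≤-respʳ-≈ (shift-by (fromℚ δ))
        (≤-respˡ-≈ (begin
          fromℚ (ℚ.- δ) + (u + fromℚ δ) ≈⟨ +-comm _ _ ⟩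
          u + fromℚ δ + fromℚ (ℚ.- δ)   ≈⟨ +-congˡ (-‿homo δ) ⟩
          u + fromℚ δ + - fromℚ δ       ≈⟨ //-rightDividesʳ (fromℚ δ) u ⟩
          u                             ∎) (+-monoˡ-≤ _ lower))
    where
    -1*u≈-u : fromℚ (ℚ.- 1ℚ) * u ≈ - u
    -1*u≈-u = ≈-trans (*-congʳ (≈-trans (-‿homo 1ℚ) (-‿cong 1#-homo))) (-1*x≈-x u)

    shift-by : ∀ c → b + fromℚ (ℚ.- 1ℚ) * u + (u + c) ≈ b + c
    shift-by c = begin
      b + fromℚ (ℚ.- 1ℚ) * u + (u + c) ≈⟨ +-congʳ (+-congˡ -1*u≈-u) ⟩
      b + - u + (u + c)                ≈⟨ +-assoc _ _ _ ⟨
      b + - u + u + c                  ≈⟨ +-congʳ (//-rightDividesˡ u b) ⟩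
      b + c                            ∎

  cmp-resp : ∀ {S T} (J : S → Carrier → Carrier) (J′ : T → Carrier → Carrier) c {a a′ b b′} →
             a ≈ a′ → b ≈ b′ → ⟦_⟧ᶜ J c a b → ⟦_⟧ᶜ J′ c a′ b′
  cmp-resp J J′ equal   a≈ b≈ a≈b = ≈-trans (≈-sym a≈) (≈-trans a≈b b≈)
  cmp-resp J J′ unequal a≈ b≈ a≉b = λ a≈b → a≉b (≈-trans a≈ (≈-trans a≈b (≈-sym b≈)))
  cmp-resp J J′ geq     a≈ b≈ b≤a = ≤-respˡ-≈ b≈ (≤-respʳ-≈ a≈ b≤a)
  cmp-resp J J′ greater a≈ b≈ (b≤a , b≉a) =
    ≤-respˡ-≈ b≈ (≤-respʳ-≈ a≈ b≤a) , λ b≈a → b≉a (≈-trans b≈ (≈-trans b≈a (≈-sym a≈)))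
  cmp-resp J J′ leq     a≈ b≈ a≤b = ≤-respˡ-≈ a≈ (≤-respʳ-≈ b≈ a≤b)
  cmp-resp J J′ less    a≈ b≈ (a≤b , a≉b) =
    ≤-respˡ-≈ a≈ (≤-respʳ-≈ b≈ a≤b) , λ a≈b → a≉b (≈-trans a≈ (≈-trans a≈b (≈-sym b≈)))

  cmp-resp-⇔ : ∀ {S T} (J : S → Carrier → Carrier) (J′ : T → Carrier → Carrier) c {a a′ b b′} →
               a ≈ a′ → b ≈ b′ → ⟦_⟧ᶜ J c a b ⇔ ⟦_⟧ᶜ J′ c a′ b′
  cmp-resp-⇔ J J′ c a≈ b≈ = mk⇔ (cmp-resp J J′ c a≈ b≈) (cmp-resp J′ J c (≈-sym a≈) (≈-sym b≈))

  ∀-⇔ : ∀ {P Q : Carrier → Set} → (∀ a → P a ⇔ Q a) → (∀ a → P a) ⇔ (∀ a → Q a)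
  ∀-⇔ P⇔Q = mk⇔ (λ p a → Equivalence.to (P⇔Q a) (p a)) (λ q a → Equivalence.from (P⇔Q a) (q a))

  ∃-⇔ : ∀ {P Q : Carrier → Set} → (∀ a → P a ⇔ Q a) → ∃ P ⇔ ∃ Q
  ∃-⇔ P⇔Q = mk⇔ (λ (a , p) → a , Equivalence.to (P⇔Q a) p)
                (λ (a , q) → a , Equivalence.from (P⇔Q a) q)

  -- Congruence up to `≈` is confined to terms without function symbols, because an interpretation
  -- `J` is an arbitrary function that is not assumed to respect `≈`. Terms with function symbols
  -- are compared up to `≡` instead.
  term-cong⊥ : ∀ (t : Term ⊥ Var) {ω ω′} → (∀ {v} → v ∈ fvTerm t → ω v ≈ ω′ v) →
               ⟦_⟧ J⊥ t ω ≈ ⟦_⟧ J⊥ t ω′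
  term-cong⊥ (var x) eq = eq (here refl)
  term-cong⊥ (con q) eq = ≈-refl
  term-cong⊥ (s ⊕ t) eq =
    +-cong (term-cong⊥ s (eq ∘ ∈-++⁺ˡ)) (term-cong⊥ t (eq ∘ ∈-++⁺ʳ (fvTerm s)))
  term-cong⊥ (s ⊗ t) eq =
    *-cong (term-cong⊥ s (eq ∘ ∈-++⁺ˡ)) (term-cong⊥ t (eq ∘ ∈-++⁺ʳ (fvTerm s)))

  module _ {S : Set} (J : S → Carrier → Carrier) where

    term-bind : ∀ {V W} (σ : V → Term S W) t ω → ⟦_⟧ J (bind σ t) ω ≡ ⟦_⟧ J t (λ v → ⟦_⟧ J (σ v) ω)
    term-bind σ (var x)  ω = refl
    term-bind σ (con q)  ω = refl
    term-bind σ (s ⊕ t)  ω = cong₂ _+_ (term-bind σ s ω) (term-bind σ t ω)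
    term-bind σ (s ⊗ t)  ω = cong₂ _*_ (term-bind σ s ω) (term-bind σ t ω)
    term-bind σ (fn h t) ω = cong (J h) (term-bind σ t ω)

    term-cong : ∀ {V} (t : Term S V) {ω ω′ : V → Carrier} → (∀ v → ω v ≡ ω′ v) →
                ⟦_⟧ J t ω ≡ ⟦_⟧ J t ω′
    term-cong (var x)  eq = eq x
    term-cong (con q)  eq = refl
    term-cong (s ⊕ t)  eq = cong₂ _+_ (term-cong s eq) (term-cong t eq)
    term-cong (s ⊗ t)  eq = cong₂ _*_ (term-cong s eq) (term-cong t eq)
    term-cong (fn h t) eq = cong (J h) (term-cong t eq)

    term-↦ : ∀ w e t ω → ⟦_⟧ J (bind (w ↦ e) t) ω ≡ ⟦_⟧ J t (ω [ w ≔ ⟦_⟧ J e ω ])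
    term-↦ w e t ω = trans (term-bind (w ↦ e) t ω) (term-cong t pointwise)
      where
      pointwise : ∀ v → ⟦_⟧ J ((w ↦ e) v) ω ≡ (ω [ w ≔ ⟦_⟧ J e ω ]) v
      pointwise v with v ℕ.≟ w
      ... | yes _ = refl
      ... | no  _ = refl

    term-lift : ∀ {V} (t : Term ⊥ V) ω → ⟦_⟧ J (liftTerm t) ω ≡ ⟦_⟧ J⊥ t ω
    term-lift (var x) ω = refl
    term-lift (con q) ω = refl
    term-lift (s ⊕ t) ω = cong₂ _+_ (term-lift s ω) (term-lift t ω)
    term-lift (s ⊗ t) ω = cong₂ _*_ (term-lift s ω) (term-lift t ω)

    lift-sem : ∀ {k} (φ : Fml ⊥ fo) ω → _⊨_ J ω (lift {S} {k} φ) ⇔ _⊨_ J⊥ ω φ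
    lift-sem (cmp c s t) ω =
      cmp-resp-⇔ J J⊥ c (reflexive (term-lift s ω)) (reflexive (term-lift t ω))
    lift-sem (¬̇ φ)       ω = ¬-cong-⇔ (lift-sem φ ω)
    lift-sem (φ ∧̇ ψ)     ω = lift-sem φ ω ×-⇔ lift-sem ψ ω
    lift-sem (φ ∨̇ ψ)     ω = lift-sem φ ω ⊎-⇔ lift-sem ψ ω
    lift-sem (φ →̇ ψ)     ω = →-cong-⇔ (lift-sem φ ω) (lift-sem ψ ω)
    lift-sem (∀̇ x ∙ φ)   ω = ∀-⇔ λ a → lift-sem φ (ω [ x ≔ a ])
    lift-sem (∃̇ x ∙ φ)   ω = ∃-⇔ λ a → lift-sem φ (ω [ x ≔ a ])

  -- Bound variables are renamed as well, so both states change under a binder. Injectivity of `ρ`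
  -- keeps the update at the image of `x` away from the images of all other variables.
  rename-sem : ∀ ρ (φ : Fml ⊥ fo) {ω ω′} → (∀ {v} → v ∈ fv φ → ω (Injection.to ρ v) ≈ ω′ v) →
               _⊨_ J⊥ ω (rename ρ φ) ⇔ _⊨_ J⊥ ω′ φ
  rename-sem-update : ∀ ρ x (φ : Fml ⊥ fo) {ω ω′} a →
                      (∀ {v} → v ∈ remove x (fv φ) → ω (Injection.to ρ v) ≈ ω′ v) →
                      _⊨_ J⊥ (ω [ Injection.to ρ x ≔ a ]) (rename ρ φ) ⇔ _⊨_ J⊥ (ω′ [ x ≔ a ]) φ

  rename-sem ρ (cmp c s t) {ω} eq =
    cmp-resp-⇔ J⊥ J⊥ c (term s (eq ∘ ∈-++⁺ˡ)) (term t (eq ∘ ∈-++⁺ʳ (fvTerm s)))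
    where
    term : ∀ t {ω′} → (∀ {v} → v ∈ fvTerm t → ω (Injection.to ρ v) ≈ ω′ v) →
           ⟦_⟧ J⊥ (renameTerm ρ t) ω ≈ ⟦_⟧ J⊥ t ω′
    term t eq = ≈-trans (reflexive (term-bind J⊥ _ t ω)) (term-cong⊥ t eq)
  rename-sem ρ (¬̇ φ)     eq = ¬-cong-⇔ (rename-sem ρ φ eq)
  rename-sem ρ (φ ∧̇ ψ)   eq =
    rename-sem ρ φ (eq ∘ ∈-++⁺ˡ) ×-⇔ rename-sem ρ ψ (eq ∘ ∈-++⁺ʳ (fv φ))
  rename-sem ρ (φ ∨̇ ψ)   eq =
    rename-sem ρ φ (eq ∘ ∈-++⁺ˡ) ⊎-⇔ rename-sem ρ ψ (eq ∘ ∈-++⁺ʳ (fv φ))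
  rename-sem ρ (φ →̇ ψ)   eq =
    →-cong-⇔ (rename-sem ρ φ (eq ∘ ∈-++⁺ˡ)) (rename-sem ρ ψ (eq ∘ ∈-++⁺ʳ (fv φ)))
  rename-sem ρ (∀̇ x ∙ φ) eq = ∀-⇔ λ a → rename-sem-update ρ x φ a eq
  rename-sem ρ (∃̇ x ∙ φ) eq = ∃-⇔ λ a → rename-sem-update ρ x φ a eq

  rename-sem-update ρ x φ {ω} {ω′} a eq = rename-sem ρ φ updated
    where
    r = Injection.to ρ

    updated : ∀ {v} → v ∈ fv φ → (ω [ r x ≔ a ]) (r v) ≈ (ω′ [ x ≔ a ]) v
    updated {v} v∈ with v ℕ.≟ x
    ... | yes refl = reflexive (≔-same ω (r x) a)
    ... | no  v≢x  = ≈-trans (reflexive (≔-other ω (r x) a (v≢x ∘ Injection.injective ρ)))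
                             (eq (remove⁺ v∈ v≢x))

  -- Graphs of definable functions and closeness to them

  module _ (F : DefinableFunction ℝ) where
    open DefinableFunction F

    -- Only the variables `0` and `1` are free in the formula, so the constant state serves to give
    -- variable `0` the value `a`.
    Graph : Carrier → Carrier → Set
    Graph a b = _⊨_ J⊥ ((λ _ → a) [ 1 ≔ b ]) formula

    graph-rename : ∀ N {ω a b} → ω N ≈ a → ω (suc N) ≈ b →
                   _⊨_ J⊥ ω (rename (shift N) formula) ⇔ Graph a b
    graph-rename N {ω} {a} {b} a≈ b≈ = rename-sem (shift N) formula (agree ∘ scoped)
      where
      agree : ∀ {v} → v ∈ 0 ∷ 1 ∷ [] → ω (N ℕ.+ v) ≈ ((λ _ → a) [ 1 ≔ b ]) v
      agree (here refl)         rewrite ℕ.+-identityʳ N = a≈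
      agree (there (here refl)) rewrite ℕ.+-comm N 1    = b≈

    Near : ℚ → Carrier → Carrier → Set
    Near δ a u = ∃ λ b → Graph a b × b + fromℚ (ℚ.- δ) ≤ u × u ≤ b + fromℚ δ

  near : ℕ → DefinableFunction ℝ → ℚ → Term ⊥ Var → Var → Fml ⊥ fo
  near N F δ e w = withValue ℝ N F e λ z → within (var z ⊕ con (ℚ.- δ)) w (var z ⊕ con δ)

  module _ (ω : State) (N : ℕ) (n b : Carrier) where

    private
      ω₂ : State
      ω₂ = (ω [ N ≔ n ]) [ suc N ≔ b ]

    update₂-N : ω₂ N ≡ n
    update₂-N = trans (≔-other (ω [ N ≔ n ]) (suc N) b (ℕ.<⇒≢ (ℕ.n<1+n N)))
                      (≔-same ω N n)

    update₂-sucN : ω₂ (suc N) ≡ b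
    update₂-sucN = ≔-same (ω [ N ≔ n ]) (suc N) b

    update₂-below : ∀ {v} → v ℕ.< N → ω₂ v ≡ ω v
    update₂-below v<N = trans (≔-other (ω [ N ≔ n ]) (suc N) b (ℕ.<⇒≢ (ℕ.m<n⇒m<1+n v<N)))
                              (≔-other ω N n (ℕ.<⇒≢ v<N))

  withValue-graph : ∀ {S} k (J : S → Carrier → Carrier) N F ω n b →
    let ω₂ = (ω [ N ≔ n ]) [ suc N ≔ b ] in
    _⊨_ J ω₂ (lift {S} {k} (rename (shift N) (DefinableFunction.formula F))) ⇔ Graph F n b
  withValue-graph k J N F ω n b = mk⇔
    (Equivalence.to renamed ∘ Equivalence.to lifted)
    (Equivalence.from lifted ∘ Equivalence.from renamed)
    where
    lifted  = lift-sem J {k} (rename (shift N) (DefinableFunction.formula F)) _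
    renamed = graph-rename F N {(ω [ N ≔ n ]) [ suc N ≔ b ]}
            (reflexive (update₂-N ω N n b)) (reflexive (update₂-sucN ω N n b))

  -- Renaming by `shift 0` is a detour: `graph-rename` accepts states up to `≈`, so one and the same
  -- renamed formula can be read with `a` or with `a′`.
  graph-resp : ∀ F {a a′ b} → a ≈ a′ → Graph F a b → Graph F a′ b
  graph-resp F {a} {a′} {b} a≈ = Equivalence.to (graph-rename F 0 {(λ _ → a) [ 1 ≔ b ]} a≈ ≈-refl)
                               ∘ Equivalence.from (graph-rename F 0 {(λ _ → a) [ 1 ≔ b ]} ≈-refl ≈-refl)

  near-resp : ∀ F δ {a a′ u u′} → a ≈ a′ → u ≈ u′ → Near F δ a u → Near F δ a′ u′
  near-resp F δ a≈ u≈ (b , g , l , r) = b , graph-resp F a≈ g , ≤-respʳ-≈ u≈ l , ≤-respˡ-≈ u≈ r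

  module _ (N : ℕ) (F : DefinableFunction ℝ) (δ : ℚ) (e : Term ⊥ Var) (w : Var)
           (e<N : ∀ {v} → v ∈ fvTerm e → v ℕ.< N) (w<N : w ℕ.< N) {ω : State} where

    -- The auxiliary variables `N` and `suc N` hold the argument and its approximate value; as `e`
    -- and `w` live below `N`, updating these two does not change them.
    near⁻ : _⊨_ J⊥ ω (near N F δ e w) → Near F δ (⟦_⟧ J⊥ e ω) (ω w)
    near⁻ (n , b , n≈ , g , l , r)
      rewrite update₂-N ω N n b | update₂-sucN ω N n b | update₂-below ω N n b w<N =
      b , graph-resp F (≈-trans n≈ (term-cong⊥ e λ v∈ → reflexive (update₂-below ω N n b (e<N v∈))))
                       (Equivalence.to (withValue-graph fo J⊥ N F ω n b) g) , l , r

    near⁺ : Near F δ (⟦_⟧ J⊥ e ω) (ω w) → _⊨_ J⊥ ω (near N F δ e w)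
    near⁺ (b , g , l , r) = n , b
      , ≈-trans (reflexive (update₂-N ω N n b))
                (≈-sym (term-cong⊥ e λ v∈ → reflexive (update₂-below ω N n b (e<N v∈))))
      , Equivalence.from (withValue-graph fo J⊥ N F ω n b) g
      , ≤-respˡ-≈ (≈-sym (+-congʳ b≈)) (≤-respʳ-≈ (≈-sym w≈) l)
      , ≤-respʳ-≈ (≈-sym (+-congʳ b≈)) (≤-respˡ-≈ (≈-sym w≈) r)
      where
      n = ⟦_⟧ J⊥ e ω
      b≈ = reflexive (update₂-sucN ω N n b)
      w≈ = reflexive (update₂-below ω N n b w<N)

-- Transfer between a formula and its perturbation

lift-bounded : ∀ {S k} q y g (χ : Fml ⊥ fo) →
               lift {S} {k} (bounded q y g χ) ≡ bounded q y (lift g) (lift χ)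
lift-bounded all y g χ = refl
lift-bounded ex  y g χ = refl

lift-atom : ∀ {S k} r t → lift {S} {k} (atom r t) ≡ atom r (liftTerm t)
lift-atom ≥0 t = refl
lift-atom >0 t = refl

fv-atom : ∀ {S k} r (t : Term S Var) {v} → v ∈ fvTerm t → v ∈ fv {k = k} (atom r t)
fv-atom ≥0 t = ∈-++⁺ˡ
fv-atom >0 t = ∈-++⁺ˡ

fv-atom⁻ : ∀ {S k} r (t : Term S Var) {v} → v ∈ fv {k = k} (atom r t) → v ∈ fvTerm t
fv-atom⁻ ≥0 t v∈ with ∈-++⁻ (fvTerm t) v∈
... | inj₁ v∈t = v∈t
fv-atom⁻ >0 t v∈ with ∈-++⁻ (fvTerm t) v∈
... | inj₁ v∈t = v∈t

fv-bounded⁺ : ∀ {S k} q y (g χ : Fml S k) {v} → v ∈ fv g ++ fv χ → v ≢ y → v ∈ fv (bounded q y g χ)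
fv-bounded⁺ all y g χ = remove⁺
fv-bounded⁺ ex  y g χ = remove⁺

fv-bounded⁻ : ∀ {S k} q y (g χ : Fml S k) {v} → v ∈ fv (bounded q y g χ) → v ∈ fv g ++ fv χ × v ≢ y
fv-bounded⁻ all y g χ = remove⁻
fv-bounded⁻ ex  y g χ = remove⁻

∉-bounded : ∀ {S k} q y (g χ : Fml S k) → y ∉ fv (bounded q y g χ)
∉-bounded q y g χ y∈ = proj₂ (fv-bounded⁻ q y g χ y∈) refl

fv-within-lower : ∀ {S k} (a : Term S Var) y b {v} → v ∈ fvTerm a → v ∈ fv {k = k} (within a y b)
fv-within-lower a y b = ∈-++⁺ˡ ∘ ∈-++⁺ˡ

fv-within-upper : ∀ {S k} (a : Term S Var) y b {v} → v ∈ fvTerm b → v ∈ fv {k = k} (within a y b)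
fv-within-upper a y b = ∈-++⁺ʳ (fvTerm a ++ y ∷ []) ∘ there

module Transfer (ℝ : RealNumbers) (δ : ℚ) where
  open RealNumbers ℝ
  open Semantics ℝ
  open RealLemmas ℝ

  private
    S  = Symbol ℝ
    Tm = Term S Var

  InBounds : (Var → IQ) → List Var → State → Set
  InBounds B V ω = ∀ {v} → v ∈ V → ω v ∈ᴵ B v

  restore : S → Term ⊥ Var → Var → Tm → Tm
  restore h e w = bind (w ↦ fn h (liftTerm e))

  -- χ is the perturbed formula and ψ the original one.
  Directed : Quantifier → (Fml S dl → Fml S dl → Set) → Fml S dl → Fml S dl → Set
  Directed all _⇒_ χ ψ = χ ⇒ ψ
  Directed ex  _⇒_ χ ψ = ψ ⇒ χ

  -- Entails B V χ ψ: under the assumptions v ∈ B v for v ∈ V, χ entails ψ.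
  -- The semantic and the proof-theoretic reading of entailment both have
  -- the closure properties below, so the induction over φ is done once.
  record Entailment : Set₁ where
    field
      Entails      : (Var → IQ) → List Var → Fml S dl → Fml S dl → Set
      -- Arguments in the first interval, in use `I_e`, have values that lie in the second,
      -- `I_{f(e)}`, and within `δ` of the definable function. How this is expressed depends on the
      -- reading of entailment.
      Approximates : DefinableFunction ℝ → IQ → IQ → S → Set
      weaken : ∀ {B B′ V V′ χ ψ} → (∀ {v} → v ∈ V → v ∈ V′ × B v ≡ B′ v) →
               Entails B V χ ψ → Entails B′ V′ χ ψ
      reflexive-⊢ : ∀ {B V χ} → Entails B V χ χ
      ∧-mono : ∀ {B V χ χ′ ψ ψ′} → Entails B V χ ψ → Entails B V χ′ ψ′ →
               Entails B V (χ ∧̇ χ′) (ψ ∧̇ ψ′)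
      ∨-mono : ∀ {B V χ χ′ ψ ψ′} → Entails B V χ ψ → Entails B V χ′ ψ′ →
               Entails B V (χ ∨̇ χ′) (ψ ∨̇ ψ′)
      -- The side condition on the guard is semantic in either reading: it involves no function
      -- symbols, so the calculus obtains it by `real`.
      bounded-mono : ∀ q {B V y χ ψ} (g : Fml ⊥ fo) → y ∉ V →
                     (∀ ω → InBounds B V ω → _⊨_ J⊥ ω g → ω y ∈ᴵ B y) →
                     Entails B (y ∷ V) χ ψ →
                     Entails B V (bounded q y (lift g) χ) (bounded q y (lift g) ψ)
      -- The induction step for atoms. Here `B w` is the interval of `f(e)`, and `N` lies above all
      -- variables in sight, so that the auxiliary variables of `near` interfere with none of them.
      replacement : ∀ q {B F K h e w t N χ r} → let V = fvTerm (restore h e w t) in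
                    Approximates F K (B w) h →
                    (∀ ω → InBounds B V ω → ⟦_⟧ J⊥ e ω ∈ᴵ K) →
                    (∀ {v} → v ∈ fvTerm e → v ∈ V) → w ∉ V → (∀ {v} → v ∈ w ∷ V → v ℕ.< N) →
                    Directed q (Entails B (w ∷ V)) (lift χ) (atom r t) →
                    Directed q (Entails B V) (lift (bounded q w (near N F δ e w) χ))
                                             (atom r (restore h e w t))

  module _ (E : Entailment) where
    open Entailment E

    -- What the induction has to know at a single subterm. The variable case records membership in
    -- `used`, from which the fresh `w` is seen not to occur in the atom.
    Suitable : Approximation ℝ → (Tm → IQ) → List Var → Tm → Set
    Suitable F I used (var x)    = x ∈ used
    Suitable F I used (con q)    = fromℚ q ∈ᴵ I (con q)
    Suitable F I used (s ⊕ t)    = ∀ {a b} → a ∈ᴵ I s → b ∈ᴵ I t → a + b ∈ᴵ I (s ⊕ t)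
    Suitable F I used (s ⊗ t)    = ∀ {a b} → a ∈ᴵ I s → b ∈ᴵ I t → a * b ∈ᴵ I (s ⊗ t)
    Suitable F I used (fn h e)   = Approximates (F h e) (I e) (I (fn h e)) h

    AllSuitable : Approximation ℝ → (Tm → IQ) → List Var → List Tm → Set
    AllSuitable F I used ts = ∀ {s} → s ∈ ts → Suitable F I used s

    enclosed : ∀ {F I used ω} (e : Term ⊥ Var) → AllSuitable F I used (subterms (liftTerm e)) →
               InBounds (I ∘ var) (fvTerm e) ω → ⟦_⟧ J⊥ e ω ∈ᴵ I (liftTerm e)
    enclosed (var x) ok bd = bd (here refl)
    enclosed (con q) ok bd = ok (here refl)
    enclosed (s ⊕ t) ok bd = ok (here refl)
      (enclosed s (ok ∘ there ∘ ∈-++⁺ˡ) (bd ∘ ∈-++⁺ˡ))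
      (enclosed t (ok ∘ there ∘ ∈-++⁺ʳ (subterms (liftTerm s))) (bd ∘ ∈-++⁺ʳ (fvTerm s)))
    enclosed (s ⊗ t) ok bd = ok (here refl)
      (enclosed s (ok ∘ there ∘ ∈-++⁺ˡ) (bd ∘ ∈-++⁺ˡ))
      (enclosed t (ok ∘ there ∘ ∈-++⁺ʳ (subterms (liftTerm s))) (bd ∘ ∈-++⁺ʳ (fvTerm s)))

    -- With `F` and `I` read through `back`, every condition on compound terms is literally the old
    -- one. Only variables change: `w` itself joins `used`.
    suitable-bind : ∀ {F I used w e} s → let back = bind (w ↦ e) in
                    Suitable F I used (back s) →
                    Suitable (λ g → F g ∘ back) (I ∘ back) (w ∷ used) s
    suitable-bind {w = w} (var x) ok with x ℕ.≟ w
    ... | yes refl = here refl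
    ... | no  _    = there ok
    suitable-bind (con q)  ok = ok
    suitable-bind (s ⊕ t)  ok = ok
    suitable-bind (s ⊗ t)  ok = ok
    suitable-bind (fn h e) ok = ok

    fvTerm⊆used : ∀ {F I used} t → AllSuitable F I used (subterms t) →
                  ∀ {v} → v ∈ fvTerm t → v ∈ used
    fvTerm⊆used t ok = ok ∘ fvTerm⇒subterms t

    weaken-directed : ∀ q {B B′ V V′ χ ψ} → (∀ {v} → v ∈ V → v ∈ V′ × B v ≡ B′ v) →
                      Directed q (Entails B V) χ ψ → Directed q (Entails B′ V′) χ ψ
    weaken-directed all = weaken
    weaken-directed ex  = weaken

    widen : ∀ q {B V V′ χ ψ} → (∀ {v} → v ∈ V → v ∈ V′) →
            Directed q (Entails B V) χ ψ → Directed q (Entails B V′) χ ψ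
    widen q V⊆ = weaken-directed q λ v∈ → V⊆ v∈ , refl

    ∧-directed : ∀ q {B V χ χ′ ψ ψ′} → let _⇒_ = Directed q (Entails B V) in
                 χ ⇒ ψ → χ′ ⇒ ψ′ → (χ ∧̇ χ′) ⇒ (ψ ∧̇ ψ′)
    ∧-directed all = ∧-mono
    ∧-directed ex  = ∧-mono

    ∨-directed : ∀ q {B V χ χ′ ψ ψ′} → let _⇒_ = Directed q (Entails B V) in
                 χ ⇒ ψ → χ′ ⇒ ψ′ → (χ ∨̇ χ′) ⇒ (ψ ∨̇ ψ′)
    ∨-directed all = ∨-mono
    ∨-directed ex  = ∨-mono

    atom-transfer : ∀ q {r used F t χ I} → AtomPerturbation ℝ q δ r used F t χ →
                    AllSuitable F I used (subterms t) →
                    Directed q (Entails (I ∘ var) (fvTerm t)) (lift χ) (atom r t)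
    atom-transfer all {r} (done t) ok rewrite lift-atom {S} {dl} r t = reflexive-⊢
    atom-transfer ex  {r} (done t) ok rewrite lift-atom {S} {dl} r t = reflexive-⊢
    atom-transfer q {r} {used} {F} {I = I} (replace {χ = χ} h e w t w∉used w∈t _ p) ok =
      -- The step yields bounds given by `I ∘ back ∘ var`; these agree with `I ∘ var` on the atom
      -- because `w` does not occur in it.
      weaken-directed q (λ {v} v∈ → v∈ , cong I (≔-other var w fe λ {refl → w∉V v∈}))
        (replacement q {B = I ∘ back ∘ var}
          (transport (λ s → Approximates (F h (liftTerm e)) (I (liftTerm e)) (I s) h) (sym back-w)
                     (ok (subterms-fe (here refl))))
          (λ ω bd → enclosed e (ok ∘ subterms-fe ∘ there)
                      λ {v} v∈ → transport (λ s → ω v ∈ᴵ I s)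
                                  (≔-other var w fe λ {refl → w∉V (e⊆V v∈)}) (bd (e⊆V v∈)))
          e⊆V w∉V below
          (widen q extend
            (atom-transfer q p λ {s} s∈ → suitable-bind s (ok (subterms-bind t s∈)))))
      where
      fe   = fn h (liftTerm e)
      back = bind (w ↦ fe)
      V    = fvTerm (back t)

      back-w : back (var w) ≡ fe
      back-w = ≔-same var w fe

      subterms-fe : ∀ {s} → s ∈ subterms fe → s ∈ subterms (back t)
      subterms-fe = subterms-image t w∈t ∘ transport (λ s → _ ∈ subterms s) (sym back-w)

      e⊆V : ∀ {v} → v ∈ fvTerm e → v ∈ V
      e⊆V {v} v∈ = fvTerm-bind⁺ t w∈t
        (transport (λ s → v ∈ fvTerm s) (sym back-w)
                   (transport (v ∈_) (sym (fvTerm-lift e)) v∈))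

      w∉V : w ∉ V
      w∉V = w∉used ∘ fvTerm⊆used (back t) ok

      below : ∀ {v} → v ∈ w ∷ V → v ℕ.< fresh (w ∷ used)
      below (here refl) = <fresh (w ∷ used) (here refl)
      below (there v∈)  = <fresh (w ∷ used) (there (fvTerm⊆used (back t) ok v∈))

      extend : ∀ {v} → v ∈ fvTerm t → v ∈ w ∷ V
      extend {v} v∈ with v ℕ.≟ w
      ... | yes refl = here refl
      ... | no  v≢w  = there (fvTerm-bind⁺ t v∈
                         (transport (λ s → v ∈ fvTerm s) (sym (≔-other var w fe v≢w)) (here refl)))

    clause-transfer : ∀ q {used F c χ I} → ClausePerturbation ℝ q δ F used c χ →
                      AllSuitable F I used (clauseTerms c) →
                      Directed q (Entails (I ∘ var) (fv {k = dl} (clauseFml c))) (lift χ) (clauseFml c)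
    clause-transfer q (lit {r} {t} p) ok = widen q (fv-atom r t) (atom-transfer q p ok)
    clause-transfer q {I = I} (_or_ {c} {d} p p′) ok = ∨-directed q
      (widen q ∈-++⁺ˡ (clause-transfer q {I = I} p (ok ∘ ∈-++⁺ˡ)))
      (widen q (∈-++⁺ʳ (fv {k = dl} (clauseFml c)))
        (clause-transfer q {I = I} p′ (ok ∘ ∈-++⁺ʳ (clauseTerms c))))

    cnf-transfer : ∀ q {used F ψ χ I} → CNFPerturbation ℝ q δ F used ψ χ →
                   AllSuitable F I used (cnfTerms ψ) →
                   Directed q (Entails (I ∘ var) (fv {k = dl} (cnfFml ψ))) (lift χ) (cnfFml ψ)
    cnf-transfer q (clause p) ok = clause-transfer q p ok
    cnf-transfer q {I = I} (_and_ {ψ} {ψ′} p p′) ok = ∧-directed q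
      (widen q ∈-++⁺ˡ (cnf-transfer q {I = I} p (ok ∘ ∈-++⁺ˡ)))
      (widen q (∈-++⁺ʳ (fv {k = dl} (cnfFml ψ)))
        (cnf-transfer q {I = I} p′ (ok ∘ ∈-++⁺ʳ (cnfTerms ψ))))

    HullsEnclosed : (Tm → IQ) → List (Var × Term ⊥ Var × Term ⊥ Var) → Set
    HullsEnclosed I bs = ∀ {y a b} → (y , a , b) ∈ bs →
                         ∀ {c} → c ∈ᴵ I (liftTerm a) ⊎ c ∈ᴵ I (liftTerm b) → c ∈ᴵ I (var y)

    transfer : ∀ q {used F φ χ I} → BoundedPerturbation ℝ q δ F used φ χ → WellScoped φ →
               AllSuitable F I used (terms φ) → HullsEnclosed I (bounds φ) →
               Directed q (Entails (I ∘ var) (fv {k = dl} (fml φ))) (lift χ) (fml φ)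
    transfer q (matrix p) _ ok _ = cnf-transfer q p ok
    transfer q {used} {F} {I = I} (quant {q′} {y} {a} {b} {φ} {χ} p) (_ , disjoint , scoped) ok hulls
      rewrite lift-bounded {S} {dl} q′ y (within a y b) χ =
        mono q (widen q extend (transfer q p scoped
          (ok ∘ there ∘ ∈-++⁺ʳ (subterms (liftTerm a)) ∘ ∈-++⁺ʳ (subterms (liftTerm b)))
          (hulls ∘ there)))
      where
      guard = within (liftTerm a) y (liftTerm b)
      V     = fv (bounded q′ y guard (fml φ))

      -- `WellScoped` keeps `y` out of its own endpoints, so their variables remain free in the
      -- quantified formula and are covered by the assumed bounds.
      endpoint : ∀ {v} → v ∈ fvTerm a ++ fvTerm b → v ∈ V
      endpoint {v} v∈ = fv-bounded⁺ q′ y guard (fml φ) (∈-++⁺ˡ in-guard)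
                          λ {refl → disjoint (here refl , v∈)}
        where
        in-guard : v ∈ fv guard
        in-guard with ∈-++⁻ (fvTerm a) v∈
        ... | inj₁ v∈a = fv-within-lower {k = dl} (liftTerm a) y (liftTerm b)
                           (transport (v ∈_) (sym (fvTerm-lift a)) v∈a)
        ... | inj₂ v∈b = fv-within-upper {k = dl} (liftTerm a) y (liftTerm b)
                           (transport (v ∈_) (sym (fvTerm-lift b)) v∈b)

      extend : ∀ {v} → v ∈ fv {k = dl} (fml φ) → v ∈ y ∷ V
      extend {v} v∈ with v ℕ.≟ y
      ... | yes refl = here refl
      ... | no  v≢y  = there (fv-bounded⁺ q′ y guard (fml φ) (∈-++⁺ʳ (fv guard) v∈) v≢y)

      -- Interval arithmetic encloses both endpoints, the hull condition puts them into the interval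
      -- of `y`, and convexity gives everything between them.
      y∈ : ∀ ω → InBounds (I ∘ var) V ω → _⊨_ J⊥ {fo} ω (within a y b) → ω y ∈ᴵ I (var y)
      y∈ ω bd (a≤y , y≤b) = ∈ᴵ-convex {K = I (var y)}
        (hulls (here refl) (inj₁ (enclosed a (ok ∘ there ∘ ∈-++⁺ˡ) (bd ∘ endpoint ∘ ∈-++⁺ˡ))))
        (hulls (here refl) (inj₂ (enclosed b (ok ∘ there ∘ ∈-++⁺ʳ (subterms (liftTerm a)) ∘ ∈-++⁺ˡ)
                                           (bd ∘ endpoint ∘ ∈-++⁺ʳ (fvTerm a)))))
        a≤y y≤b

      y∉V : y ∉ V
      y∉V = ∉-bounded q′ y guard (fml φ)

      mono : ∀ q {χ ψ} → Directed q (Entails (I ∘ var) (y ∷ V)) χ ψ →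
             Directed q (Entails (I ∘ var) V) (bounded q′ y guard χ) (bounded q′ y guard ψ)
      mono all = bounded-mono q′ (within a y b) y∉V y∈
      mono ex  = bounded-mono q′ (within a y b) y∉V y∈

module _ (ℝ : RealNumbers) where

  -- The conjunct of approximationPremise for f(e), with K = I_e.
  closeOn : ∀ {S} → Var → IQ → DefinableFunction ℝ → ℚ → S → Fml S dl
  closeOn s K F δ h =
    ∀[ s ∈ K ] withValue ℝ (suc s) F (var s) λ z →
      let d = var z ⊕ neg (fn h (var s)) in con (ℚ.- δ) ≤̇ d ∧̇ d ≤̇ con δ

applications∈ : ∀ {S} (φ : BoundedFml S) {h e} → fn h e ∈ terms φ → (h , e) ∈ functionTerms φ
applications∈ φ fe∈ = ∈-concatMap⁺ applications (lose fe∈ (here refl))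

-- Soundness

module SemanticTransfer (ℝ : RealNumbers) (δ : ℚ)
                        (J : Symbol ℝ → RealNumbers.Carrier ℝ → RealNumbers.Carrier ℝ) where
  open RealNumbers ℝ
  open Semantics ℝ
  open RealLemmas ℝ
  open Transfer ℝ δ

  private
    S  = Symbol ℝ
    _⊨J_ : State → Fml S dl → Set
    _⊨J_ = _⊨_ J
    infix 3 _⊨J_

  atom-resp : ∀ r {t t′ ω ω′} → ⟦_⟧ J t ω ≡ ⟦_⟧ J t′ ω′ → ω ⊨J atom r t → ω′ ⊨J atom r t′
  atom-resp ≥0 = transport (fromℚ 0ℚ ≤_)
  atom-resp >0 = transport (RealNumbers._<_ ℝ (fromℚ 0ℚ))

  InBounds-update : ∀ {B V ω x a} → x ∉ V → InBounds B V ω → InBounds B V (ω [ x ≔ a ])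
  InBounds-update {B} {ω = ω} {x} {a} x∉V bd {v} v∈ =
    transport (_∈ᴵ B v) (sym (≔-other ω x a λ {refl → x∉V v∈})) (bd v∈)

  InBounds-∷ : ∀ {B V ω x} → ω x ∈ᴵ B x → InBounds B V ω → InBounds B (x ∷ V) ω
  InBounds-∷ x∈ bd (here refl) = x∈
  InBounds-∷ x∈ bd (there v∈)  = bd v∈

  private
    Entails : (Var → IQ) → List Var → Fml S dl → Fml S dl → Set
    Entails B V χ ψ = ∀ ω → InBounds B V ω → ω ⊨J χ → ω ⊨J ψ

    Approximates : DefinableFunction ℝ → IQ → IQ → S → Set
    Approximates F K K′ h = ∀ a → a ∈ᴵ K → J h a ∈ᴵ K′ × Near F δ a (J h a)

    weaken : ∀ {B B′ V V′ χ ψ} → (∀ {v} → v ∈ V → v ∈ V′ × B v ≡ B′ v) →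
             Entails B V χ ψ → Entails B′ V′ χ ψ
    weaken V⊆ χ⇒ψ ω bd = χ⇒ψ ω λ {v} v∈ →
      let v∈V′ , B≡ = V⊆ v∈ in transport (ω v ∈ᴵ_) (sym B≡) (bd v∈V′)

    module _ {B : Var → IQ} {V : List Var} {y : Var} {g : Fml ⊥ fo} (y∉V : y ∉ V)
             (y∈ : ∀ ω → InBounds B V ω → _⊨_ J⊥ ω g → ω y ∈ᴵ B y) where

      InBounds-guard : ∀ {ω} a → InBounds B V ω → ω [ y ≔ a ] ⊨J lift g →
                       InBounds B (y ∷ V) (ω [ y ≔ a ])
      InBounds-guard {ω} a bd guard = 
        InBounds-∷ {B} (y∈ _ bd′ (Equivalence.to (lift-sem J g _) guard)) bd′
        where
        bd′ : InBounds B V (ω [ y ≔ a ])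
        bd′ = InBounds-update {B} {ω = ω} y∉V bd

      bounded-mono : ∀ q {χ ψ} → Entails B (y ∷ V) χ ψ →
                     Entails B V (bounded q y (lift g) χ) (bounded q y (lift g) ψ)
      bounded-mono all χ⇒ψ ω bd f a guard = χ⇒ψ _ (InBounds-guard a bd guard) (f a guard)
      bounded-mono ex  χ⇒ψ ω bd (a , guard , x) = a , guard , χ⇒ψ _ (InBounds-guard a bd guard) x

    module _ {B : Var → IQ} {F : DefinableFunction ℝ} {K : IQ} {h : S} {e : Term ⊥ Var} {w : Var}
             {t : Term S Var} {N : ℕ} {χ : Fml ⊥ fo} {r : Rel₀} (approx : Approximates F K (B w) h)
             (e∈K : ∀ ω → InBounds B (fvTerm (restore h e w t)) ω → ⟦_⟧ J⊥ e ω ∈ᴵ K)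
             (e⊆V : ∀ {v} → v ∈ fvTerm e → v ∈ fvTerm (restore h e w t))
             (w∉V : w ∉ fvTerm (restore h e w t))
             (<N : ∀ {v} → v ∈ w ∷ fvTerm (restore h e w t) → v ℕ.< N) where

      fe : Term S Var
      fe = fn h (liftTerm e)

      V : List Var
      V = fvTerm (restore h e w t)

      module _ {ω} (bd : InBounds B V ω) where

        value : Carrier
        value = ⟦_⟧ J fe ω

        ω′ : State
        ω′ = ω [ w ≔ value ]

        ω′w : ω′ w ≡ value
        ω′w = ≔-same ω w value

        approx-value : value ∈ᴵ B w × Near F δ (⟦_⟧ J⊥ e ω) value
        approx-value = transport (λ a → J h a ∈ᴵ B w × Near F δ (⟦_⟧ J⊥ e ω) (J h a))
          (sym (term-lift J e ω)) (approx _ (e∈K ω bd))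

        bd′ : InBounds B (w ∷ V) ω′
        bd′ = InBounds-∷ {B} (transport (_∈ᴵ B w) (sym ω′w) (proj₁ approx-value))
                             (InBounds-update {B} {ω = ω} w∉V bd)

        guard : ω′ ⊨J lift (near N F δ e w)
        guard = Equivalence.from (lift-sem J (near N F δ e w) ω′)
          (near⁺ N F δ e w (<N ∘ there ∘ e⊆V) (<N (here refl))
            (near-resp F δ
              (term-cong⊥ e λ v∈ → reflexive (sym (≔-other ω w value λ {refl → w∉V (e⊆V v∈)})))
              (reflexive (sym ω′w)) (proj₂ approx-value)))

        value-eq : ⟦_⟧ J t ω′ ≡ ⟦_⟧ J (restore h e w t) ω
        value-eq = sym (term-↦ J w fe t ω)

      replacement : ∀ q → Directed q (Entails B (w ∷ V)) (lift χ) (atom r t) →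
                    Directed q (Entails B V) (lift (bounded q w (near N F δ e w) χ))
                                             (atom r (restore h e w t))
      replacement all χ⇒t ω bd f =
        atom-resp r (value-eq bd) (χ⇒t (ω′ bd) (bd′ bd) (f (value bd) (guard bd)))
      replacement ex  t⇒χ ω bd x =
        value bd , guard bd , t⇒χ (ω′ bd) (bd′ bd) (atom-resp r (sym (value-eq bd)) x)

  entailment : Entailment
  entailment = record
    { Entails      = Entails
    ; Approximates = Approximates
    ; weaken       = λ {B} {B′} {χ = χ} {ψ} → weaken {B} {B′} {χ = χ} {ψ}
    ; reflexive-⊢  = λ ω _ x → x
    ; ∧-mono       = λ χ⇒ψ χ⇒ψ′ ω bd (x , x′) → χ⇒ψ ω bd x , χ⇒ψ′ ω bd x′
    ; ∨-mono       = λ χ⇒ψ χ⇒ψ′ ω bd → Sum.map (χ⇒ψ ω bd) (χ⇒ψ′ ω bd)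
    ; bounded-mono = λ q {B} g y∉V y∈ → bounded-mono {B} {g = g} y∉V y∈ q
    ; replacement  = λ q {B} {F} {K} {h} {e} {w} {t} {N} {χ} {r} approx e∈K e⊆V w∉V <N →
                       replacement {B} {F} {K} {h} {e} {w} {t} {N} {χ} {r} approx e∈K e⊆V w∉V <N q
    }

  -- The list `ys` accumulates the variables whose quantifiers have already been opened, together
  -- with their bounds.
  closure-valid : ∀ xs {ys} (I : Term S Var → IQ) χ →
                  (∀ ω → InBounds (I ∘ var) (xs ++ ys) ω → ω ⊨J χ) →
                  ∀ ω → InBounds (I ∘ var) ys ω → ω ⊨J foldr (λ x → ∀[ x ∈ I (var x) ]_) χ xs
  closure-valid []       I χ valid ω bd = valid ω bd
  closure-valid (x ∷ xs) {ys} I χ valid ω bd a x∈ = closure-valid xs {x ∷ ys} I χ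
    (λ ω bd → valid ω (bd ∘ ∈-shift)) _ extended
    where
    ∈-shift : ∀ {v} → v ∈ x ∷ xs ++ ys → v ∈ xs ++ x ∷ ys
    ∈-shift (here refl) = ∈-++⁺ʳ xs (here refl)
    ∈-shift (there v∈) with ∈-++⁻ xs v∈
    ... | inj₁ v∈xs = ∈-++⁺ˡ v∈xs
    ... | inj₂ v∈ys = ∈-++⁺ʳ xs (there v∈ys)

    extended : InBounds (I ∘ var) (x ∷ ys) (ω [ x ≔ a ])
    extended (here refl) = x∈
    extended {v} (there v∈) with v ℕ.≟ x
    -- A variable quantified again: its new value obeys the same interval.
    ... | yes refl = transport (_∈ᴵ I (var x)) (≔-same ω x a) x∈
    ... | no  v≢x  = bd v∈

  ⋀-elim-valid : ∀ {φs φ} ω → φ ∈ φs → ω ⊨J ⋀ φs → ω ⊨J φ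
  ⋀-elim-valid ω (here refl) (x , _)  = x
  ⋀-elim-valid ω (there φ∈)  (_ , xs) = ⋀-elim-valid ω φ∈ xs

  closeOn-valid : ∀ {s K F h} → Valid J (closeOn ℝ s K F δ h) →
                  ∀ a → a ∈ᴵ K → Near F δ a (J h a)
  closeOn-valid {s} {K} {F} {h} valid a a∈K =
    near-value (valid ω₀ a (transport (_∈ᴵ K) (sym s≡) a∈K))
    where
    ω₀ ω : State
    ω₀ = λ _ → 0#
    ω  = ω₀ [ s ≔ a ]

    s≡ : ω s ≡ a
    s≡ = ≔-same ω₀ s a

    near-value : ω ⊨J withValue ℝ (suc s) F (var s) (λ z →
                   let d = var z ⊕ neg (fn h (var s)) in con (ℚ.- δ) ≤̇ d ∧̇ d ≤̇ con δ) →
                 Near F δ a (J h a)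
    near-value (n , b , n≈ , g , l , u)
      rewrite update₂-N ω (suc s) n b | update₂-sucN ω (suc s) n b
            | update₂-below ω (suc s) n b (ℕ.n<1+n s) | s≡ =
      b , graph-resp F n≈ (Equivalence.to (withValue-graph dl J (suc s) F ω n b) g)
        , difference-bounds δ l u

  -- Interval facts supplied by a valid enclosure

  module _ {φ : BoundedFml S} {I : Term S Var → IQ}
           (encl : ∀ {χ} → EnclosureCondition 1ℚ φ I χ → Valid J χ) where

    private
      x = fresh₀ φ

      ω₀ : State
      ω₀ = λ _ → 0#

      module _ (a b : Carrier) where
        ω₁ ω₂ : State
        ω₁ = ω₀ [ x ≔ a ]
        ω₂ = ω₁ [ suc x ≔ b ]

        first : ω₁ x ≡ a
        first = ≔-same ω₀ x a

        first₂ : ω₂ x ≡ a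
        first₂ = update₂-N ω₀ x a b

        second : ω₂ (suc x) ≡ b
        second = update₂-sucN ω₀ x a b

    con-enclosed : ∀ {q} → con q ∈ terms φ → fromℚ q ∈ᴵ I (con q)
    con-enclosed q∈ = encl (constant q∈) ω₀

    sum-enclosed : ∀ {s t a b} → s ⊕ t ∈ terms φ → a ∈ᴵ I s → b ∈ᴵ I t → a + b ∈ᴵ I (s ⊕ t)
    sum-enclosed {s} {t} {a} {b} st∈ a∈ b∈ =
      transport (_∈ᴵ I (s ⊕ t)) (cong₂ _+_ (first₂ a b) (second a b))
        (encl (sum st∈) ω₀ a (transport (_∈ᴵ I s) (sym (first a b)) a∈)
                           b (transport (_∈ᴵ I t) (sym (second a b)) b∈))

    product-enclosed : ∀ {s t a b} → s ⊗ t ∈ terms φ → a ∈ᴵ I s → b ∈ᴵ I t → a * b ∈ᴵ I (s ⊗ t)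
    product-enclosed {s} {t} {a} {b} st∈ a∈ b∈ =
      transport (_∈ᴵ I (s ⊗ t)) (cong₂ _*_ (first₂ a b) (second a b))
        (encl (product st∈) ω₀ a (transport (_∈ᴵ I s) (sym (first a b)) a∈)
                               b (transport (_∈ᴵ I t) (sym (second a b)) b∈))

    application-enclosed : ∀ {h e a} → fn h e ∈ terms φ → a ∈ᴵ I e → J h a ∈ᴵ I (fn h e)
    application-enclosed {h} {e} {a} fe∈ a∈ =
      ∈ᴵ-resp {K = I (fn h e)} (≈-trans (+-congˡ 0#-homo) (+-identityʳ (J h a)))
        (transport (_∈ᴵ I (fn h e)) (cong₂ (λ a b → J h a + b) (first₂ a 0ᴿ) (second a 0ᴿ))
          (encl (application fe∈) ω₀ a (transport (_∈ᴵ I e) (sym (first a 0ᴿ)) a∈)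
            0ᴿ (transport (λ r → fromℚ (ℚ.- 1ℚ) ≤ r × r ≤ fromℚ 1ℚ) (sym (second a 0ᴿ)) 0∈[-1,1])))
      where
      0ᴿ = fromℚ 0ℚ

    hulls-enclosed : ∀ {y a b} → (y , a , b) ∈ bounds φ →
                     ∀ {c} → c ∈ᴵ I (liftTerm a) ⊎ c ∈ᴵ I (liftTerm b) → c ∈ᴵ I (var y)
    hulls-enclosed {y} {a} {b} b∈ {c} c∈ =
      transport (_∈ᴵ I (var y)) (≔-same ω₀ x c)
        (encl (bound b∈) ω₀ c
          (transport (λ c → c ∈ᴵ I (liftTerm a) ⊎ c ∈ᴵ I (liftTerm b)) (sym (≔-same ω₀ x c)) c∈))

    -- The reading of entailment matters only at applications; the other cases are semantic, so the
    -- validity of the enclosure settles them for both readings.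
    all-suitable : ∀ E {F} →
      (∀ {h e} → fn h e ∈ terms φ → Entailment.Approximates E (F h e) (I e) (I (fn h e)) h) →
      AllSuitable E F I (variables φ) (terms φ)
    all-suitable E approx {var v}   v∈  = ∈-concatMap⁺ fvTerm (lose v∈ (here refl))
    all-suitable E approx {con q}   q∈  = con-enclosed q∈
    all-suitable E approx {s ⊕ t}   st∈ = sum-enclosed st∈
    all-suitable E approx {s ⊗ t}   st∈ = product-enclosed st∈
    all-suitable E approx {fn h e}  fe∈ = approx fe∈

-- Derivability

module _ {S : Set} where

  NotFree : ∀ {k} → Var → List (Fml S k) → Set
  NotFree x Γ = ∀ {φ} → φ ∈ Γ → x ∉ fv φ

  notFree⇒∉ : ∀ {k} {x} (Γ : List (Fml S k)) → NotFree x Γ → x ∉ concatMap fv Γ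
  notFree⇒∉ Γ nf x∈ = let φ , φ∈ , x∈φ = find (∈-concatMap⁻ fv {xs = Γ} x∈) in nf φ∈ x∈φ

  notFree-∷ : ∀ {k x} {φ : Fml S k} {Γ} → x ∉ fv φ → NotFree x Γ → NotFree x (φ ∷ Γ)
  notFree-∷ x∉ nf (here refl) = x∉
  notFree-∷ x∉ nf (there φ∈)  = nf φ∈

  fresh-notFree : ∀ {k x} (Γ : List (Fml S k)) → fresh (concatMap fv Γ) ℕ.≤ x → NotFree x Γ
  fresh-notFree Γ ≤x φ∈ x∈ =
    ℕ.<-irrefl refl (ℕ.<-≤-trans (<fresh (concatMap fv Γ) (∈-concatMap⁺ fv (lose φ∈ x∈))) ≤x)

  inBounds : ∀ {k} → (Var → IQ) → List Var → List (Fml S k)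
  inBounds B = List.map λ v → var v ∈̇ B v

  inBounds-notFree : ∀ {k x B V} → x ∉ V → NotFree x (inBounds {k} B V)
  inBounds-notFree {B = B} x∉V φ∈ x∈ with ∈-map⁻ (λ v → var v ∈̇ B v) φ∈
  inBounds-notFree x∉V φ∈ (here refl)         | v , v∈ , refl = x∉V v∈
  inBounds-notFree x∉V φ∈ (there (here refl)) | v , v∈ , refl = x∉V v∈

  admissible-atom : ∀ {k} (σ : Subst S) r t → Admissible σ (atom {k = k} r t)
  admissible-atom σ ≥0 t = tt
  admissible-atom σ >0 t = tt

  subst-atom : ∀ {k} (σ : Subst S) r t → subst σ (atom {k = k} r t) ≡ atom r (bind σ t)
  subst-atom σ ≥0 t = refl
  subst-atom σ >0 t = refl

  -- A form of the capture condition for a binder `y` that does not refer to the formula under the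
  -- binder.
  Avoids : Subst S → Var → Set
  Avoids σ y = ∀ {v} → v ≢ y → y ∉ fvTerm (σ v)

  ↦-avoids : ∀ {x e y} → y ∉ fvTerm e → Avoids (x ↦ e) y
  ↦-avoids {x} y∉e {v} v≢y y∈ with v ℕ.≟ x
  ... | yes _ = y∉e y∈
  ... | no  _ with here refl ← y∈ = v≢y refl

  except-avoids : ∀ {σ x y} → Avoids σ y → Avoids (σ except x) y
  except-avoids {x = x} avoids {v} v≢y y∈ with v ℕ.≟ x
  ... | yes refl with here refl ← y∈ = v≢y refl
  ... | no  _    = avoids v≢y y∈

map-lift-inBounds : ∀ {S k} B V → List.map (lift {S} {k}) (inBounds B V) ≡ inBounds B V
map-lift-inBounds B V = sym (List.map-∘ V)

-- Derived rules of the sequent calculus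

module DerivedRules (ℝ : RealNumbers) {S : Set}
                    (J : S → RealNumbers.Carrier ℝ → RealNumbers.Carrier ℝ)
                    (FunctionAxiom : Fml S dl → Set) (Premise : Fml S dl → Set) where
  open Semantics ℝ
  open Calculus ℝ J FunctionAxiom

  infix 3 _⊢_

  _⊢_ : List (Fml S dl) → List (Fml S dl) → Set
  Γ ⊢ Δ = Premise ⊩ Γ ⊢ Δ

  weakenL : ∀ {Γ Γ′ Δ} → Γ ⊆ Γ′ → Γ ⊢ Δ → Γ′ ⊢ Δ
  weakenL Γ⊆ = struct Γ⊆ id

  cut₁ : ∀ {Γ Δ} φ → Γ ⊢ φ ∷ [] → φ ∷ Γ ⊢ Δ → Γ ⊢ Δ
  cut₁ φ d = cut φ (struct id (λ {(here refl) → here refl}) d)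

  cut-theorem : ∀ {Γ Δ} φ → [] ⊢ φ ∷ [] → φ ∷ Γ ⊢ Δ → Γ ⊢ Δ
  cut-theorem φ d = cut₁ φ (weakenL (λ ()) d)

  -- The gate through which arithmetic enters: `Γ₀` is the part of the antecedent without function
  -- symbols that semantically implies `φ`.
  cut-real : ∀ {Γ Δ} (Γ₀ : List (Fml ⊥ fo)) φ → List.map lift Γ₀ ⊆ Γ →
             (∀ ω → All (_⊨_ J⊥ ω) Γ₀ → _⊨_ J⊥ ω φ) → lift φ ∷ Γ ⊢ Δ → Γ ⊢ Δ
  cut-real Γ₀ φ Γ₀⊆ valid =
    cut₁ (lift φ) (weakenL Γ₀⊆ (real {Γ = Γ₀} {Δ = φ ∷ []} λ ω ⊨Γ₀ → here (valid ω ⊨Γ₀)))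

  -- The primed left rules act on a formula anywhere in the antecedent and keep it. The instance is
  -- given up to `≡`, as `subst` does not reduce past undecided variable comparisons.
  ∀L′ : ∀ {Γ Δ x φ} e → Admissible (x ↦ e) φ → ∀ {ψ} → subst (x ↦ e) φ ≡ ψ →
        (∀̇ x ∙ φ) ∈ Γ → ψ ∷ Γ ⊢ Δ → Γ ⊢ Δ
  ∀L′ e adm refl ∀φ∈ d = cut₁ _ (ident ∀φ∈ (here refl)) (∀L e adm d)

  →L′ : ∀ {Γ Δ φ ψ} → (φ →̇ ψ) ∈ Γ → Γ ⊢ φ ∷ [] → ψ ∷ Γ ⊢ Δ → Γ ⊢ Δ
  →L′ φ→ψ∈ dφ dψ = cut₁ _ (ident φ→ψ∈ (here refl))
    (→L (struct id (λ {(here refl) → here refl}) dφ) dψ)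

  ∧L′ : ∀ {Γ Δ φ ψ} → (φ ∧̇ ψ) ∈ Γ → φ ∷ ψ ∷ Γ ⊢ Δ → Γ ⊢ Δ
  ∧L′ φ∧ψ∈ d = cut₁ _ (ident φ∧ψ∈ (here refl)) (∧L d)

  -- Replacing `x` by itself is the identity and hence always admissible, whatever `φ` binds.
  ∀L-self : ∀ {Γ Δ x φ} → (∀̇ x ∙ φ) ∈ Γ → φ ∷ Γ ⊢ Δ → Γ ⊢ Δ
  ∀L-self {x = x} {φ} = ∀L′ (var x) (admissible-fixed φ fixes) (subst-fixed φ fixes)
    where
    fixes : (x ↦ var x) Fixes fv φ
    fixes = ↦-self-fixes x (fv φ)

  ∃R-self : ∀ {Γ Δ x φ} → Γ ⊢ φ ∷ Δ → Γ ⊢ (∃̇ x ∙ φ) ∷ Δ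
  ∃R-self {Γ} {Δ} {x} {φ} d = ∃R (var x) (admissible-fixed φ fixes)
    (transport (λ φ → Γ ⊢ φ ∷ Δ) (sym (subst-fixed φ fixes)) d)
    where
    fixes : (x ↦ var x) Fixes fv φ
    fixes = ↦-self-fixes x (fv φ)

  ∀R′ : ∀ {Γ x φ} → NotFree x Γ → Γ ⊢ φ ∷ [] → Γ ⊢ (∀̇ x ∙ φ) ∷ []
  ∀R′ {Γ} nf = ∀R (notFree⇒∉ Γ nf) (λ ())

  ∃L′ : ∀ {Γ x φ ψ} → NotFree x (ψ ∷ Γ) → φ ∷ Γ ⊢ ψ ∷ [] → (∃̇ x ∙ φ) ∷ Γ ⊢ ψ ∷ []
  ∃L′ {Γ} {ψ = ψ} nf = ∃L (notFree⇒∉ Γ (nf ∘ there))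
                       (notFree⇒∉ (ψ ∷ []) λ {(here refl) → nf (here refl)})

  -- `real` does not speak about function symbols, but it proves reflexivity for a quantified
  -- variable, which is then instantiated at `t`.
  term-refl : ∀ {Γ Δ} t → Γ ⊢ (t ≐ t) ∷ Δ
  term-refl t = cut-real [] (∀̇ 0 ∙ var 0 ≐ var 0) (λ ()) (λ _ _ _ → ≈-refl)
                  (∀L t tt (ident (here refl) (here refl)))
    where open RealLemmas ℝ

  leibniz : ∀ {Γ Δ s t} x φ → Admissible (x ↦ s) φ → Admissible (x ↦ t) φ →
            ∀ {ψ χ} → subst (x ↦ s) φ ≡ ψ → subst (x ↦ t) φ ≡ χ →
            (s ≐ t) ∈ Γ → ψ ∈ Γ → χ ∷ Γ ⊢ Δ → Γ ⊢ Δ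
  leibniz x φ adm adm′ refl refl s≐t∈ ψ∈ d =
    cut-theorem _ (axiom (Leibniz x _ _ φ adm adm′))
      (→L (ident s≐t∈ (here refl)) (→L (ident ψ∈ (here refl)) d))

  -- Gives `t` a variable as its name, from the existential statement witnessed by `t`. Both
  -- orientations of the equation are provided because Leibniz rewriting goes from left to right
  -- only.
  cut-name : ∀ {Γ ψ} x t → x ∉ fvTerm t → NotFree x (ψ ∷ Γ) →
             var x ≐ t ∷ t ≐ var x ∷ Γ ⊢ ψ ∷ [] → Γ ⊢ ψ ∷ []
  cut-name {Γ} {ψ} x t x∉t nf d = cut₁ (∃̇ x ∙ var x ≐ t ∧̇ t ≐ var x)
    (∃R t (tt , tt)
      (transport (λ φ → Γ ⊢ φ ∷ []) (sym instance≡) (∧R (term-refl t) (term-refl t))))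
    (∃L′ nf (∧L d))
    where
    instance≡ : subst (x ↦ t) (var x ≐ t ∧̇ t ≐ var x) ≡ (t ≐ t ∧̇ t ≐ t)
    instance≡ rewrite ≔-same (var {S = S}) x t
                    | bind-fixed {σ = x ↦ t} t (↦-fixes (fvTerm t) x∉t) = refl

  ⋀-elim : ∀ {φs φ} → φ ∈ φs → [] ⊢ ⋀ φs ∷ [] → [] ⊢ φ ∷ []
  ⋀-elim (here refl) d = cut₁ _ d (∧L (ident (here refl) (here refl)))
  ⋀-elim (there φ∈)  d = ⋀-elim φ∈ (cut₁ _ d (∧L (ident (there (here refl)) (here refl))))

-- Entailment read as derivability under interval hypotheses

module SyntacticTransfer (ℝ : RealNumbers) (δ : ℚ)
                         (J : Symbol ℝ → RealNumbers.Carrier ℝ → RealNumbers.Carrier ℝ)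
                         (FunctionAxiom : Fml (Symbol ℝ) dl → Set)
                         (Premise : Fml (Symbol ℝ) dl → Set) where
  open RealNumbers ℝ
  open Semantics ℝ
  open RealLemmas ℝ
  open Transfer ℝ δ
  open Calculus ℝ J FunctionAxiom using (ident; struct; ∧L; ∧R; ∨L; ∨R; →R)
  open DerivedRules ℝ J FunctionAxiom Premise

  private
    S  = Symbol ℝ

    Entails : (Var → IQ) → List Var → Fml S dl → Fml S dl → Set
    Entails B V χ ψ = χ ∷ inBounds B V ⊢ ψ ∷ []

    -- With `M` for the argument and `suc M` for its value under `f`, the facts about `f` become a
    -- formula without function symbols; the auxiliary variables of `near` start right above these
    -- two.
    near-named : DefinableFunction ℝ → IQ → Var → Fml ⊥ fo
    near-named F K′ M = var (suc M) ∈̇ K′ ∧̇ near (suc (suc M)) F δ (var M) (suc M)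

    -- Stated for large variables M and M + 1 instead of e and w, because the
    -- bound variables of the premise may occur in e or coincide with w.
    Approximates : DefinableFunction ℝ → IQ → IQ → S → Set
    Approximates F K K′ h = ∃ λ M₀ → ∀ M → M₀ ℕ.≤ M →
      var M ∈̇ K ∷ var (suc M) ≐ fn h (var M) ∷ fn h (var M) ≐ var (suc M) ∷ [] ⊢
      lift (near-named F K′ M) ∷ []

    ⊨inBounds : ∀ {B V ω} → All (_⊨_ J⊥ {fo} ω) (inBounds B V) → InBounds B V ω
    ⊨inBounds {B} ⊨B v∈ = All.lookup ⊨B (∈-map⁺ (λ v → var v ∈̇ B v) v∈)

    ∷⁺ : ∀ {A : Set} {x : A} {xs ys} → xs ⊆ ys → x ∷ xs ⊆ x ∷ ys
    ∷⁺ xs⊆ (here refl) = here refl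
    ∷⁺ xs⊆ (there x∈)  = there (xs⊆ x∈)

    cut-bounds : ∀ {Γ Δ B V} φ₀ φ → lift φ₀ ∈ Γ → inBounds B V ⊆ Γ →
                 (∀ ω → InBounds B V ω → _⊨_ J⊥ ω φ₀ → _⊨_ J⊥ ω φ) →
                 lift φ ∷ Γ ⊢ Δ → Γ ⊢ Δ
    cut-bounds {B = B} {V} φ₀ φ φ₀∈ B⊆ valid = cut-real (φ₀ ∷ inBounds B V) φ
      (λ { (here refl) → φ₀∈
         ; (there φ∈)  → B⊆ (transport (_ ∈_) (map-lift-inBounds B V) φ∈) })
      (λ { ω (⊨φ₀ ∷ ⊨B) → valid ω (⊨inBounds {B} {V} ⊨B) ⊨φ₀ })

    weaken : ∀ {B B′ V V′ χ ψ} → (∀ {v} → v ∈ V → v ∈ V′ × B v ≡ B′ v) →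
             Entails B V χ ψ → Entails B′ V′ χ ψ
    weaken {B} {B′} {V} {V′} V⊆ = weakenL (∷⁺ bounds⊆)
      where
      bounds⊆ : inBounds {S} {dl} B V ⊆ inBounds B′ V′
      bounds⊆ φ∈ with ∈-map⁻ (λ v → var v ∈̇ B v) φ∈
      ... | v , v∈ , refl with V⊆ v∈
      ...   | v∈′ , B≡ rewrite B≡ = ∈-map⁺ (λ v → var v ∈̇ B′ v) v∈′

    ∧-mono : ∀ {B V χ χ′ ψ ψ′} → Entails B V χ ψ → Entails B V χ′ ψ′ →
             Entails B V (χ ∧̇ χ′) (ψ ∧̇ ψ′)
    ∧-mono d d′ = ∧L (∧R (weakenL (∷⁺ there) d) (weakenL there d′))

    ∨-mono : ∀ {B V χ χ′ ψ ψ′} → Entails B V χ ψ → Entails B V χ′ ψ′ →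
             Entails B V (χ ∨̇ χ′) (ψ ∨̇ ψ′)
    ∨-mono d d′ = ∨L (∨R (struct id (∷⁺ λ ()) d)) (∨R (struct id there d′))

    module _ {B : Var → IQ} {V : List Var} {y : Var} {g : Fml ⊥ fo} (y∉V : y ∉ V)
             (y∈ : ∀ ω → InBounds B V ω → _⊨_ J⊥ ω g → ω y ∈ᴵ B y) where

      -- Real arithmetic turns the guard and the bounds on `V` into the one hypothesis that is
      -- missing, the bound on `y`.
      guarded : ∀ {Γ χ ψ} → Entails B (y ∷ V) χ ψ → χ ∈ Γ → lift g ∈ Γ → inBounds B V ⊆ Γ →
                Γ ⊢ ψ ∷ []
      guarded d χ∈ g∈ B⊆ = cut-bounds {B = B} {V} g (var y ∈̇ B y) g∈ B⊆ y∈
        (weakenL (λ { (here refl) → there χ∈ ; (there (here refl)) → here refl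
                    ; (there (there φ∈)) → there (B⊆ φ∈) }) d)

      bounded-mono : ∀ q {χ ψ} → Entails B (y ∷ V) χ ψ →
                     Entails B V (bounded q y (lift g) χ) (bounded q y (lift g) ψ)
      bounded-mono all {χ} d =
        ∀R′ (notFree-∷ {φ = ∀̇ y ∙ (lift g →̇ χ)} (∉-bounded all y (lift g) χ) (inBounds-notFree {B = B} y∉V))
          (→R (∀L-self (there (here refl))
            (→L′ (here refl) (ident (there (here refl)) (here refl))
              (guarded d (here refl) (there (there (here refl))) (there ∘ there ∘ there ∘ there)))))
      bounded-mono ex  {ψ = ψ} d =
        ∃L′ (notFree-∷ {φ = ∃̇ y ∙ (lift g ∧̇ ψ)} (∉-bounded ex y (lift g) ψ) (inBounds-notFree {B = B} y∉V))
          (∧L (∃R-self (∧R (ident (here refl) (here refl))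
            (guarded d (there (here refl)) (here refl) (there ∘ there)))))

    module _ {B : Var → IQ} {F : DefinableFunction ℝ} {K : IQ} {h : S} {e : Term ⊥ Var} {w : Var}
             {t : Term S Var} {N : ℕ} {χ : Fml ⊥ fo} {r : Rel₀} (approx : Approximates F K (B w) h)
             (e∈K : ∀ ω → InBounds B (fvTerm (restore h e w t)) ω → ⟦_⟧ J⊥ e ω ∈ᴵ K)
             (e⊆V : ∀ {v} → v ∈ fvTerm e → v ∈ fvTerm (restore h e w t))
             (w∉V : w ∉ fvTerm (restore h e w t))
             (<N : ∀ {v} → v ∈ w ∷ fvTerm (restore h e w t) → v ℕ.< N) where

      fe : Term S Var
      fe = fn h (liftTerm e)

      V : List Var
      V = fvTerm (restore h e w t)

      named : List (Fml S dl)
      named = var w ≐ fe ∷ fe ≐ var w ∷ inBounds B V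

      w∉fe : w ∉ fvTerm fe
      w∉fe = w∉V ∘ e⊆V ∘ transport (w ∈_) (fvTerm-lift e)

      -- The facts about `f` are available only for the large names `M` and `U`. Naming `e` by `M`
      -- and `f(M)` by `U`, the equations force `w = U`, and the facts can be moved to `e` and `w`.
      near-value : named ⊢ lift (var w ∈̇ B w ∧̇ near N F δ e w) ∷ []
      near-value =
        cut-name M (liftTerm e) M∉e M-fresh
          (cut-name U (fn h (var M)) (λ {(here U≡M) → ℕ.1+n≢n U≡M})
            (λ { (here refl) → U-fresh (here refl)
               ; (there (here refl)) → U∉M≐e
               ; (there (there (here refl))) → U∉e≐M
               ; (there (there (there φ∈))) → U-fresh (there φ∈) })
            (cut-bounds {B = B} {V} (var M ≐ e) (var M ∈̇ K) (there (there (here refl)))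
                (there ∘ there ∘ there ∘ there ∘ there ∘ there)
                (λ ω bd M≈e → ∈ᴵ-resp {K = K} (≈-sym M≈e) (e∈K ω bd))
              (cut₁ (lift (near-named F (B w) M))
                (weakenL (λ { (here refl) → here refl ; (there φ∈) → there (⊆-two φ∈) })
                         (proj₂ approx M M₀≤M))
                -- From `M = e`, the equation `f(M) = U` becomes `f(e) = U`.
                (leibniz {t = liftTerm e} M (fn h (var M) ≐ var U) tt tt
                    (cong₂ (λ s t → fn h s ≐ t) (≔-same var M (var M)) (≔-other var M (var M) ℕ.1+n≢n))
                    (cong₂ (λ s t → fn h s ≐ t) (≔-same var M _) (≔-other var M _ ℕ.1+n≢n))
                    (there (there (there (there (here refl))))) (there (there (there (here refl))))
                  -- Here `M` only marks the place of rewriting: `f(e) = U` becomes `w = U`.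
                  (leibniz {s = fe} {var w} M (var M ≐ var U) tt tt
                      (cong₂ _≐_ (≔-same var M _) (≔-other var M _ ℕ.1+n≢n))
                      (cong₂ _≐_ (≔-same var M _) (≔-other var M _ ℕ.1+n≢n))
                      (⊆-skip (here refl)) (here refl)
                    -- All that remains is free of function symbols and hence arithmetic.
                    (cut-real (var w ≐ var U ∷ near-named F (B w) M ∷ var M ≐ e ∷ [])
                       (var w ∈̇ B w ∧̇ near N F δ e w)
                       (λ { (here refl) → here refl
                          ; (there (here refl)) → there (there (here refl))
                          ; (there (there (here refl))) →
                              there (there (there (there (there (there (here refl)))))) })
                       (λ { ω (w≈U ∷ (U∈ , U-near) ∷ M≈e ∷ []) →
                              ∈ᴵ-resp {K = B w} (≈-sym w≈U) U∈
                            , near⁺ N F δ e w (<N ∘ there ∘ e⊆V) (<N (here refl))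
                                (near-resp F δ M≈e (≈-sym w≈U)
                                  (near⁻ (suc U) F δ (var M) U
                                    (λ { (here refl) → ℕ.m<n⇒m<1+n (ℕ.n<1+n M) }) (ℕ.n<1+n U) U-near)) })
                       (ident (here refl) (here refl))))))))
        where
        M₀ = proj₁ approx
        ψ  = lift {S} {dl} (var w ∈̇ B w ∧̇ near N F δ e w)
        M  = M₀ ℕ.⊔ fresh (concatMap fv (ψ ∷ named))
        U  = suc M

        M₀≤M : M₀ ℕ.≤ M
        M₀≤M = ℕ.m≤m⊔n _ _

        M-fresh : NotFree M (ψ ∷ named)
        M-fresh = fresh-notFree (ψ ∷ named) (ℕ.m≤n⊔m M₀ _)

        U-fresh : NotFree U (ψ ∷ named)
        U-fresh = fresh-notFree (ψ ∷ named) (ℕ.m≤n⇒m≤1+n (ℕ.m≤n⊔m M₀ _))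

        M∉e : M ∉ fvTerm (liftTerm e)
        M∉e M∈ = M-fresh (there (here refl)) (there M∈)

        U∉e : U ∉ fvTerm (liftTerm e)
        U∉e U∈ = U-fresh (there (here refl)) (there U∈)

        U∉M≐e : U ∉ fv {k = dl} (var M ≐ liftTerm e)
        U∉M≐e (here U≡M) = ℕ.1+n≢n U≡M
        U∉M≐e (there U∈) = U∉e U∈

        U∉e≐M : U ∉ fv {k = dl} (liftTerm e ≐ var M)
        U∉e≐M U∈ with ∈-++⁻ (fvTerm (liftTerm e)) U∈
        ... | inj₁ U∈e        = U∉e U∈e
        ... | inj₂ (here U≡M) = ℕ.1+n≢n U≡M

        ⊆-two : ∀ {x y : Fml S dl} {Γ} → x ∷ y ∷ [] ⊆ x ∷ y ∷ Γ
        ⊆-two (here refl) = here refl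
        ⊆-two (there (here refl)) = there (here refl)

        ⊆-skip : ∀ {x : Fml S dl} {y₁ y₂ y₃ y₄ y₅ y₆ y₇ y₈ Γ} →
                 x ∈ Γ → x ∈ y₁ ∷ y₂ ∷ y₃ ∷ y₄ ∷ y₅ ∷ y₆ ∷ y₇ ∷ y₈ ∷ Γ
        ⊆-skip = there ∘ there ∘ there ∘ there ∘ there ∘ there ∘ there ∘ there

      value⊆ : ∀ {φ} → named ⊆ var w ≐ fe ∷ fe ≐ var w ∷ φ ∷ inBounds B V
      value⊆ (here refl)         = here refl
      value⊆ (there (here refl)) = there (here refl)
      value⊆ (there (there φ∈))  = there (there (there φ∈))

      w∉atom : w ∉ fv {k = dl} (atom r (restore h e w t))
      w∉atom = w∉V ∘ fv-atom⁻ r (restore h e w t)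

      w∉bounded : ∀ q → w ∉ fv (lift {S} {dl} (bounded q w (near N F δ e w) χ))
      w∉bounded q rewrite lift-bounded {S} {dl} q w (near N F δ e w) χ =
        ∉-bounded q w (lift (near N F δ e w)) (lift χ)

      w-notFree : ∀ {φ ψ : Fml S dl} → w ∉ fv φ → w ∉ fv ψ → NotFree w (ψ ∷ φ ∷ inBounds B V)
      w-notFree w∉φ w∉ψ (here refl)         = w∉ψ
      w-notFree w∉φ w∉ψ (there (here refl)) = w∉φ
      w-notFree w∉φ w∉ψ (there (there φ∈))  = inBounds-notFree {B = B} w∉V φ∈

      -- The quantified variable `w` itself is chosen as the name of `f(e)`. The quantifier is then
      -- instantiated at its own variable, so nothing is substituted into `χ`; rewriting between `w`
      -- and `f(e)` happens only in the atom, which has no binders.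
      replacement : ∀ q → Directed q (Entails B (w ∷ V)) (lift χ) (atom r t) →
                    Directed q (Entails B V) (lift (bounded q w (near N F δ e w) χ))
                                             (atom r (restore h e w t))
      replacement all d =
        cut-name w fe w∉fe (w-notFree (w∉bounded all) w∉atom)
          (cut₁ _ (weakenL value⊆ near-value)
            (∧L (∀L-self (there (there (there (there (here refl)))))
              (→L′ (here refl) (ident (there (there (here refl))) (here refl))
                (cut₁ (atom r t)
                    (weakenL (λ { (here refl) → here refl
                                ; (there (here refl)) → there (there (here refl))
                                ; (there (there φ∈)) →
                                    there (there (there (there (there (there (there φ∈)))))) }) d)
                  (leibniz {s = var w} {fe} w (atom r t)
                      (admissible-atom (w ↦ var w) r t) (admissible-atom (w ↦ fe) r t)
                      (subst-fixed (atom r t) (↦-self-fixes w (fv (atom r t)))) (subst-atom (w ↦ fe) r t)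
                      (there (there (there (there (there (here refl)))))) (here refl)
                    (ident (here refl) (here refl))))))))
      replacement ex  d =
        cut-name w fe w∉fe (w-notFree w∉atom (w∉bounded ex))
          (cut₁ _ (weakenL value⊆ near-value)
            (∧L (leibniz {s = fe} {var w} w (atom r t)
                  (admissible-atom (w ↦ fe) r t) (admissible-atom (w ↦ var w) r t)
                  (subst-atom (w ↦ fe) r t) (subst-fixed (atom r t) (↦-self-fixes w (fv (atom r t))))
                  (there (there (there (here refl)))) (there (there (there (there (here refl)))))
                (∃R-self (∧R (ident (there (there (here refl))) (here refl))
                  (weakenL (λ { (here refl) → here refl
                              ; (there (here refl)) → there (here refl)
                              ; (there (there φ∈)) →
                                  there (there (there (there (there (there φ∈))))) }) d))))))

  entailment : Entailment
  entailment = record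
    { Entails      = Entails
    ; Approximates = Approximates
    ; weaken       = λ {B} {B′} {χ = χ} {ψ} → weaken {B} {B′} {χ = χ} {ψ}
    ; reflexive-⊢  = ident (here refl) (here refl)
    ; ∧-mono       = λ {B} → ∧-mono {B}
    ; ∨-mono       = λ {B} → ∨-mono {B}
    ; bounded-mono = λ q {B} g y∉V y∈ → bounded-mono {B} {g = g} y∉V y∈ q
    ; replacement  = λ q {B} {F} {K} {h} {e} {w} {t} {N} {χ} {r} approx e∈K e⊆V w∉V <N →
                       replacement {B} {F} {K} {h} {e} {w} {t} {N} {χ} {r} approx e∈K e⊆V w∉V <N q
    }

  -- Distinctness makes each `x` an eigenvariable: it is not free in the bounds on `ys`, the
  -- variables introduced so far.
  closure-provable : ∀ xs {ys} (I : Term S Var → IQ) χ → Unique xs → (∀ {v} → v ∈ xs → v ∉ ys) →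
                     inBounds (I ∘ var) (xs ++ ys) ⊢ χ ∷ [] →
                     inBounds (I ∘ var) ys ⊢ foldr (λ x → ∀[ x ∈ I (var x) ]_) χ xs ∷ []
  closure-provable []       I χ unique disjoint d = d
  closure-provable (x ∷ xs) {ys} I χ (x∉ ∷ unique) disjoint d =
    ∀R′ (inBounds-notFree {B = I ∘ var} (disjoint (here refl)))
      (→R (closure-provable xs {x ∷ ys} I χ unique
        (λ { v∈xs (here refl) → All.lookup x∉ v∈xs refl
           ; v∈xs (there v∈ys) → disjoint (there v∈xs) v∈ys })
        (weakenL bounds⊆ d)))
    where
    B = I ∘ var

    bounds⊆ : inBounds {S} {dl} B (x ∷ xs ++ ys) ⊆ inBounds B (xs ++ x ∷ ys)
    bounds⊆ φ∈ with ∈-map⁻ (λ v → var v ∈̇ B v) φ∈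
    ... | v , here refl , refl = ∈-map⁺ (λ v → var v ∈̇ B v) (∈-++⁺ʳ xs (here refl))
    ... | v , there v∈ , refl  =
      ∈-map⁺ (λ v → var v ∈̇ B v) ([ ∈-++⁺ˡ , ∈-++⁺ʳ xs ∘ there ]′ (∈-++⁻ xs v∈))

  fv-definingFormula : ∀ {S k} (F : DefinableFunction ℝ) N {v} →
                       v ∈ fv (lift {S} {k} (rename (shift N) (DefinableFunction.formula F))) →
                       v ∈ N ∷ suc N ∷ []
  fv-definingFormula {S} {k} F N {v} v∈
    with fv-rename (shift N) formula (transport (v ∈_) (fv-lift {S} {k} (rename (shift N) formula)) v∈)
    where open DefinableFunction F
  ... | u , u∈ , refl with DefinableFunction.scoped F u∈
  ...   | here refl         rewrite ℕ.+-identityʳ N = here refl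
  ...   | there (here refl) rewrite ℕ.+-comm N 1    = there (here refl)

  -- Deriving the facts about f from the enclosure and the premise

  enclosedApplication : Var → IQ → IQ → S → Fml S dl
  enclosedApplication s K K′ h =
    ∀[ s ∈ K ] bounded all (suc s) (within (con (ℚ.- 1ℚ)) (suc s) (con 1ℚ))
                         ((fn h (var s) ⊕ var (suc s)) ∈̇ K′)

  module _ {s : Var} {K K′ : IQ} {F : DefinableFunction ℝ} {h : S}
           (encl : [] ⊢ enclosedApplication s K K′ h ∷ [])
           (close : [] ⊢ closeOn ℝ s K F δ h ∷ []) where
    private
      N = suc s

    module _ (M : ℕ) (N<M : suc N ℕ.< M) where
      private
        U = suc M
        fM = fn h (var M)

        N<M′ : N ℕ.< M
        N<M′ = ℕ.<-trans (ℕ.n<1+n N) N<M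

        M≢N : M ≢ N
        M≢N = ℕ.>⇒≢ N<M′

        M≢sN : M ≢ suc N
        M≢sN = ℕ.>⇒≢ N<M

        context : List (Fml S dl)
        context = var M ∈̇ K ∷ var U ≐ fM ∷ fM ≐ var U ∷ []

      application-in : context ⊢ (var U ∈̇ K′) ∷ []
      application-in =
        cut-theorem _ encl
          (∀L′ (var M)
            ((tt , tt)
            , (λ {v} _ v≢N → ↦-avoids {e = var M} (λ {(here N≡M) → M≢N (sym N≡M)}) v≢N)
            , (tt , tt) , (tt , tt))
            {ψ = var M ∈̇ K →̇ bounded all N (within (con (ℚ.- 1ℚ)) N (con 1ℚ)) ((fM ⊕ var N) ∈̇ K′)}
            instance-M (here refl)
            (→L′ (here refl) (ident (there (there (here refl))) (here refl))
              -- The remainder is taken to be `0`.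
              (∀L′ (con 0ℚ) ((tt , tt) , (tt , tt))
                {ψ = (con (ℚ.- 1ℚ) ≤̇ con 0ℚ ∧̇ con 0ℚ ≤̇ con 1ℚ) →̇ (fM ⊕ con 0ℚ) ∈̇ K′}
                instance-0 (here refl)
                (→L′ (here refl)
                  (cut-real [] (con (ℚ.- 1ℚ) ≤̇ con 0ℚ ∧̇ con 0ℚ ≤̇ con 1ℚ) (λ ()) (λ _ _ → 0∈[-1,1])
                    (ident (here refl) (here refl)))
                  -- Exchanging `f(M)` for its name `U` lets arithmetic remove the summand `0`.
                  (leibniz {s = fM} {var U} U ((var U ⊕ con 0ℚ) ∈̇ K′) (tt , tt) (tt , tt)
                    {ψ = (fM ⊕ con 0ℚ) ∈̇ K′} {χ = (var U ⊕ con 0ℚ) ∈̇ K′}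
                    (instance-U fM) (instance-U (var U))
                    (there (there (there (there (there (there (there (here refl)))))))) (here refl)
                    (cut-real ((var U ⊕ con 0ℚ) ∈̇ K′ ∷ []) (var U ∈̇ K′) (∷⁺ λ ())
                      (λ { ω (U∈ ∷ []) →
                           ∈ᴵ-resp {K = K′} (≈-trans (+-congˡ 0#-homo) (+-identityʳ (ω U))) U∈ })
                      (ident (here refl) (here refl))))))))
        where
        range : ∀ {k} → Term S Var → Fml S k
        range r = con (ℚ.- 1ℚ) ≤̇ r ∧̇ r ≤̇ con 1ℚ

        instance-M : subst (s ↦ var M) (var s ∈̇ K →̇
                       (∀̇ N ∙ range (var N) →̇ (fn h (var s) ⊕ var N) ∈̇ K′)) ≡
                     (var M ∈̇ K →̇ (∀̇ N ∙ range (var N) →̇ (fM ⊕ var N) ∈̇ K′))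
        instance-M rewrite ≔-same (s ↦ var {S} M) N (var N)
                         | ≔-other (s ↦ var {S} M) N (var N) (ℕ.<⇒≢ (ℕ.n<1+n s))
                         | ≔-same (var {S}) s (var M) = refl

        instance-0 : subst (N ↦ con 0ℚ) (range (var N) →̇ (fM ⊕ var N) ∈̇ K′) ≡
                     (range (con 0ℚ) →̇ (fM ⊕ con 0ℚ) ∈̇ K′)
        instance-0 rewrite ≔-same (var {S}) N (con 0ℚ)
                         | ≔-other (var {S}) N (con 0ℚ) M≢N = refl

        instance-U : ∀ t → subst {k = dl} (U ↦ t) ((var U ⊕ con 0ℚ) ∈̇ K′) ≡ (t ⊕ con 0ℚ) ∈̇ K′
        instance-U t rewrite ≔-same (var {S}) U t = refl

      private
        difference : ∀ {T k} → Term T Var → Fml T k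
        difference u = con (ℚ.- δ) ≤̇ d ∧̇ d ≤̇ con δ
          where d = var (suc N) ⊕ neg u

        F-at-N : Fml ⊥ fo
        F-at-N = rename (shift N) (DefinableFunction.formula F)

        close-body : Term S Var → Fml S dl
        close-body m = var N ≐ m ∧̇ lift F-at-N ∧̇ difference (fn h m)

      close-in : context ⊢ (∃̇ N ∙ ∃̇ suc N ∙ close-body (var M)) ∷ []
      close-in =
        cut-theorem _ close
          (∀L′ (var M) admissible instance-M (here refl)
            (→L′ (here refl) (ident (there (there (here refl))) (here refl))
              (ident (here refl) (here refl))))
        where
        σ σ₁ σ₂ : Subst S
        σ  = s ↦ var M
        σ₁ = σ except N
        σ₂ = σ₁ except suc N

        s≢N : s ≢ N
        s≢N = ℕ.<⇒≢ (ℕ.n<1+n s)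

        N≢sN : N ≢ suc N
        N≢sN = ℕ.<⇒≢ (ℕ.n<1+n N)

        σ₂-s : σ₂ s ≡ var M
        σ₂-s = trans (≔-other σ₁ (suc N) _ (ℕ.<⇒≢ (ℕ.m<n⇒m<1+n (ℕ.n<1+n s))))
                     (trans (≔-other σ N _ s≢N) (≔-same var s (var M)))

        σ₂-N : σ₂ N ≡ var N
        σ₂-N = trans (≔-other σ₁ (suc N) _ N≢sN) (≔-same σ N (var N))

        σ₂-sN : σ₂ (suc N) ≡ var (suc N)
        σ₂-sN = ≔-same σ₁ (suc N) (var (suc N))

        F-fixed : σ₂ Fixes fv (lift {S} {dl} F-at-N)
        F-fixed v∈ with fv-definingFormula F N v∈
        ... | here refl         = σ₂-N
        ... | there (here refl) = σ₂-sN

        -- The size of `M` excludes capture by `N` and `suc N`. Binders inside the formula of `F`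
        -- may well bind `M`, but `s` is not free in that formula, so nothing is replaced there.
        admissible : Admissible σ (var s ∈̇ K →̇ (∃̇ N ∙ ∃̇ suc N ∙ close-body (var s)))
        admissible = (tt , tt)
          , (λ _ → ↦-avoids {e = var M} λ {(here N≡M) → M≢N (sym N≡M)})
          , (λ _ → except-avoids {σ = σ} {N} (↦-avoids {e = var M} λ {(here sN≡M) → M≢sN (sym sN≡M)}))
          , (tt , admissible-fixed (lift F-at-N) F-fixed , (tt , tt))

        instance-M : subst σ (var s ∈̇ K →̇ (∃̇ N ∙ ∃̇ suc N ∙ close-body (var s))) ≡
                     (var M ∈̇ K →̇ (∃̇ N ∙ ∃̇ suc N ∙ close-body (var M)))
        instance-M = cong₂ _→̇_ (cong (_∈̇ K) (≔-same var s (var M)))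
          (cong (λ φ → ∃̇ N ∙ ∃̇ suc N ∙ φ)
            (cong₂ _∧̇_ (cong₂ _≐_ σ₂-N σ₂-s)
              (cong₂ _∧̇_ (subst-fixed (lift F-at-N) F-fixed)
                (cong₂ (λ z m → let d = z ⊕ neg (fn h m) in con (ℚ.- δ) ≤̇ d ∧̇ d ≤̇ con δ) σ₂-sN σ₂-s))))

      -- Shows that `N` and `suc N`, being below `M`, may serve as eigenvariables when the
      -- existential quantifiers of the premise are opened.
      near-named-lower : ∀ {v} → v ∈ fv (lift {S} {dl} (near-named F K′ M)) → M ℕ.≤ v
      near-named-lower {v} v∈ = lower (transport (v ∈_) (fv-lift {S} {dl} (near-named F K′ M)) v∈)
        where
        Z  = suc U
        sZ = suc Z

        M≤U : M ℕ.≤ U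
        M≤U = ℕ.n≤1+n M

        M≤Z : M ℕ.≤ Z
        M≤Z = ℕ.m≤n⇒m≤1+n M≤U

        M≤sZ : M ℕ.≤ sZ
        M≤sZ = ℕ.m≤n⇒m≤1+n M≤Z

        F-at-Z : List Var
        F-at-Z = fv (lift {⊥} {fo} (rename (shift Z) (DefinableFunction.formula F)))

        body : ∀ {v} → v ∈ (Z ∷ M ∷ []) ++ F-at-Z ++ (sZ ∷ U ∷ U ∷ sZ ∷ []) → M ℕ.≤ v
        body (here refl)         = M≤Z
        body (there (here refl)) = ℕ.≤-refl
        body (there (there v∈)) with ∈-++⁻ F-at-Z v∈
        ... | inj₂ (here refl)                         = M≤sZ
        ... | inj₂ (there (here refl))                 = M≤U
        ... | inj₂ (there (there (here refl)))         = M≤U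
        ... | inj₂ (there (there (there (here refl)))) = M≤sZ
        ... | inj₁ v∈F with fv-definingFormula F Z v∈F
        ...   | here refl         = M≤Z
        ...   | there (here refl) = M≤sZ

        lower : ∀ {v} → v ∈ fv (near-named F K′ M) → M ℕ.≤ v
        lower (here refl)         = M≤U
        lower (there (here refl)) = M≤U
        lower (there (there v∈))  = body (proj₁ (remove⁻ {sZ} (proj₁ (remove⁻ {Z} v∈))))

      notFree-named : ∀ {x} → x ℕ.< M → NotFree x (lift (near-named F K′ M) ∷ (var U ∈̇ K′) ∷ context)
      notFree-named x<M φ∈ x∈ = ℕ.<⇒≱ x<M (lower φ∈ x∈)
        where
        lower : ∀ {φ v} → φ ∈ lift (near-named F K′ M) ∷ (var U ∈̇ K′) ∷ context → v ∈ fv φ → M ℕ.≤ v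
        lower (here refl) v∈ = near-named-lower v∈
        lower (there (here refl)) (here refl) = ℕ.n≤1+n M
        lower (there (here refl)) (there (here refl)) = ℕ.n≤1+n M
        lower (there (there (here refl))) (here refl) = ℕ.≤-refl
        lower (there (there (here refl))) (there (here refl)) = ℕ.≤-refl
        lower (there (there (there (here refl)))) (here refl) = ℕ.n≤1+n M
        lower (there (there (there (here refl)))) (there (here refl)) = ℕ.≤-refl
        lower (there (there (there (there (here refl))))) (here refl) = ℕ.≤-refl
        lower (there (there (there (there (here refl))))) (there (here refl)) = ℕ.n≤1+n M

      near-named-in : context ⊢ lift (near-named F K′ M) ∷ []
      near-named-in =
        cut₁ (var U ∈̇ K′) application-in
          (cut₁ _ (weakenL there close-in)
            (∃L′ (notFree-named N<M′)
              (∃L′ (notFree-named N<M)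
                (∧L (∧L′ (there (here refl))
                  -- The closeness bound still mentions `f(M)`; naming it `U` completes the
                  -- translation into arithmetic.
                  (leibniz {s = fM} {var U} U (difference (var U)) (tt , tt) (tt , tt)
                      (instance-U fM) (instance-U (var U))
                      (there (there (there (there (there (there (there (here refl)))))))) (there (here refl))
                    (cut-real (difference (var U) ∷ F-at-N ∷ var N ≐ var M ∷ (var U ∈̇ K′) ∷ [])
                      (near-named F K′ M)
                      (λ { (here refl) → here refl
                         ; (there (here refl)) → there (here refl)
                         ; (there (there (here refl))) → there (there (there (here refl)))
                         ; (there (there (there (here refl)))) →
                             there (there (there (there (there (here refl))))) })
                      (λ { ω ((l , u) ∷ ⊨F ∷ N≈M ∷ U∈ ∷ []) →
                             U∈ , near⁺ (suc U) F δ (var M) U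
                                    (λ { (here refl) → ℕ.m<n⇒m<1+n (ℕ.n<1+n M) }) (ℕ.n<1+n U)
                                    -- The opened variable `suc N` holds the value of `F` at
                                    -- `N = M`.
                                    (ω (suc N)
                                    , graph-resp F N≈M
                                        (Equivalence.to (graph-rename F N {ω} ≈-refl ≈-refl) ⊨F)
                                    , difference-bounds δ l u) })
                      (ident (here refl) (here refl)))))))))
        where
        sN≢U : suc N ≢ U
        sN≢U = ℕ.<⇒≢ (ℕ.m<n⇒m<1+n N<M)

        instance-U : ∀ t → subst {k = dl} (U ↦ t) (difference (var U)) ≡ difference t
        instance-U t rewrite ≔-same (var {S}) U t | ≔-other (var {S}) U t sN≢U = refl

    approximates : Approximates F K K′ h
    -- This bound puts `M` above `s`, `N` and `suc N`, the variables that the enclosure condition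
    -- and the premise bind outside the formula of `F`.
    approximates = suc (suc N) , near-named-in

module _ (ℝ : RealNumbers) {S : Set} {J : S → RealNumbers.Carrier ℝ → RealNumbers.Carrier ℝ}
         {FunctionAxiom : Fml S dl → Set} where
  open Calculus ℝ J FunctionAxiom

  -- Makes the premise-free proofs of the enclosure conditions usable in a derivation from the
  -- premise of the rule.
  premise-mono : ∀ {P Q : Fml S dl → Set} {Γ Δ} → (∀ {φ} → P φ → Q φ) → P ⊩ Γ ⊢ Δ → Q ⊩ Γ ⊢ Δ
  premise-mono P⊆Q (premise p)            = premise (P⊆Q p)
  premise-mono P⊆Q (ident φ∈Γ φ∈Δ)        = ident φ∈Γ φ∈Δ
  premise-mono P⊆Q (struct Γ⊆ Δ⊆ d)       = struct Γ⊆ Δ⊆ (premise-mono P⊆Q d)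
  premise-mono P⊆Q (cut φ d d′)           = cut φ (premise-mono P⊆Q d) (premise-mono P⊆Q d′)
  premise-mono P⊆Q (¬L d)                 = ¬L (premise-mono P⊆Q d)
  premise-mono P⊆Q (¬R d)                 = ¬R (premise-mono P⊆Q d)
  premise-mono P⊆Q (∧L d)                 = ∧L (premise-mono P⊆Q d)
  premise-mono P⊆Q (∧R d d′)              = ∧R (premise-mono P⊆Q d) (premise-mono P⊆Q d′)
  premise-mono P⊆Q (∨L d d′)              = ∨L (premise-mono P⊆Q d) (premise-mono P⊆Q d′)
  premise-mono P⊆Q (∨R d)                 = ∨R (premise-mono P⊆Q d)
  premise-mono P⊆Q (→L d d′)              = →L (premise-mono P⊆Q d) (premise-mono P⊆Q d′)
  premise-mono P⊆Q (→R d)                 = →R (premise-mono P⊆Q d)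
  premise-mono P⊆Q (∀L e adm d)           = ∀L e adm (premise-mono P⊆Q d)
  premise-mono P⊆Q (∀R x∉Γ x∉Δ d)         = ∀R x∉Γ x∉Δ (premise-mono P⊆Q d)
  premise-mono P⊆Q (∃L x∉Γ x∉Δ d)         = ∃L x∉Γ x∉Δ (premise-mono P⊆Q d)
  premise-mono P⊆Q (∃R e adm d)           = ∃R e adm (premise-mono P⊆Q d)
  premise-mono P⊆Q (∀L-rename y y∉ d)     = ∀L-rename y y∉ (premise-mono P⊆Q d)
  premise-mono P⊆Q (∃R-rename y y∉ d)     = ∃R-rename y y∉ (premise-mono P⊆Q d)
  premise-mono P⊆Q (real {Γ} {Δ} valid)   = real {Γ = Γ} {Δ} valid
  premise-mono P⊆Q (axiom a)              = axiom a
  premise-mono P⊆Q (G d)                  = G (premise-mono P⊆Q d)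
  premise-mono P⊆Q (dW d)                 = dW (premise-mono P⊆Q d)
  premise-mono P⊆Q (dC C d d′)            = dC C (premise-mono P⊆Q d) (premise-mono P⊆Q d′)

-- Both rules from the two readings of entailment

module _ (ℝ : RealNumbers) (J : Interpretation ℝ)
         {φ : BoundedFml (Symbol ℝ)} (scoped : WellScoped φ)
         {xs : List Var} (unique : Unique xs) (fv⊆xs : ∀ {v} → v ∈ fv {k = dl} (fml φ) → v ∈ xs)
         {F : Approximation ℝ} {δ : ℚ} {I : Term (Symbol ℝ) Var → IQ}
         (encl : dL.Enclosure ℝ J 1ℚ φ I) where
  open Interpretation J
  open Semantics ℝ using (Valid)
  open Transfer ℝ δ
  open dL ℝ J

  private
    premise = approximationPremise φ F δ I

    close∈ : ∀ {h e} → fn h e ∈ terms φ →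
             closeOn ℝ (fresh₀ φ) (I e) (F h e) δ h ∈
             List.map (λ (h , e) → closeOn ℝ (fresh₀ φ) (I e) (F h e) δ h) (functionTerms φ)
    close∈ fe∈ = ∈-map⁺ (λ (h , e) → closeOn ℝ (fresh₀ φ) (I e) (F h e) δ h) (applications∈ φ fe∈)

    fml⊆xs : ∀ {v} → v ∈ fv {k = dl} (fml φ) → v ∈ xs ++ []
    fml⊆xs = ∈-++⁺ˡ ∘ fv⊆xs

    module Sem = SemanticTransfer ℝ δ ⟦_⟧ˢ
    module Syn = SyntacticTransfer ℝ δ ⟦_⟧ˢ (FunctionInterpretation ℝ) (_≡ premise)
    open DerivedRules ℝ ⟦_⟧ˢ (FunctionInterpretation ℝ) (_≡ premise)

    -- The interval facts come from the valid enclosure for every `E`; provability of the enclosure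
    -- enters only through `approx`, at the applications.
    transferred : ∀ q {χ} E →
      (∀ {h e} → fn h e ∈ terms φ → Entailment.Approximates E (F h e) (I e) (I (fn h e)) h) →
      Perturbation ℝ q δ F φ χ →
      Directed q (Entailment.Entails E (I ∘ var) (fv {k = dl} (fml φ))) (lift χ) (fml φ)
    transferred q E approx p =
      transfer E q p scoped (Sem.all-suitable encl E approx) (Sem.hulls-enclosed encl)

    approximates-sem : Valid ⟦_⟧ˢ premise → ∀ {h e} → fn h e ∈ terms φ →
                       Entailment.Approximates Sem.entailment (F h e) (I e) (I (fn h e)) h
    approximates-sem valid {h} {e} fe∈ a a∈ =
        Sem.application-enclosed encl fe∈ a∈
      , Sem.closeOn-valid {fresh₀ φ} {I e} {F h e} {h}
          (λ ω → Sem.⋀-elim-valid ω (close∈ fe∈) (valid ω)) a a∈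

    approximates-syn : ProvableEnclosure 1ℚ φ I → ∀ {h e} → fn h e ∈ terms φ →
                       Entailment.Approximates Syn.entailment (F h e) (I e) (I (fn h e)) h
    approximates-syn prov {h} {e} fe∈ = Syn.approximates {fresh₀ φ} {I e} {I (fn h e)} {F h e} {h}
      (premise-mono ℝ (λ ()) (prov (application fe∈)))
      (⋀-elim (close∈ fe∈) (Calculus.premise refl))

  rule : Quantifier → Fml ⊥ fo → Fml (Symbol ℝ) dl
  rule all χ = closure xs I (lift χ →̇ fml φ)
  rule ex  χ = closure xs I (fml φ →̇ lift χ)

  rule-sound : ∀ q {χ} → Perturbation ℝ q δ F φ χ → SoundRule premise (rule q χ)
  rule-sound q {χ} p valid ω = close q (transferred q Sem.entailment (approximates-sem valid) p)
    where
    open Semantics ℝ using (_⊨_)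

    open Entailment Sem.entailment using (Entails)

    close : ∀ q → Directed q (Entails (I ∘ var) (fv {k = dl} (fml φ))) (lift χ) (fml φ) →
            _⊨_ ⟦_⟧ˢ ω (rule q χ)
    close all χ⇒φ = Sem.closure-valid xs {[]} I (lift χ →̇ fml φ) (λ ω bd → χ⇒φ ω (bd ∘ fml⊆xs)) ω λ ()
    close ex  φ⇒χ = Sem.closure-valid xs {[]} I (fml φ →̇ lift χ) (λ ω bd → φ⇒χ ω (bd ∘ fml⊆xs)) ω λ ()

  rule-derivable : ProvableEnclosure 1ℚ φ I → ∀ q {χ} → Perturbation ℝ q δ F φ χ →
                   DerivableRule premise (rule q χ)
  rule-derivable prov q {χ} p = close q (transferred q Syn.entailment (approximates-syn prov) p)
    where
    open Entailment Syn.entailment using (Entails; weaken)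

    close : ∀ q → Directed q (Entails (I ∘ var) (fv {k = dl} (fml φ))) (lift χ) (fml φ) →
            [] ⊢ rule q χ ∷ []
    close all d = Syn.closure-provable xs {[]} I (lift χ →̇ fml φ) unique (λ _ ())
      (Calculus.→R (weaken {I ∘ var} (λ v∈ → fml⊆xs v∈ , refl) d))
    close ex  d = Syn.closure-provable xs {[]} I (fml φ →̇ lift χ) unique (λ _ ())
      (Calculus.→R (weaken {I ∘ var} (λ v∈ → fml⊆xs v∈ , refl) d))

theorem4p14 :
    ExcludedMiddle 0ℓ →
    (ℝ : RealNumbers) (J : Interpretation ℝ) →
    let open dL ℝ J in
    (φ : BoundedFml (Symbol ℝ)) → WellScoped φ →
    (xs : List Var) → Unique xs → (∀ v → v ∈ xs ⇔ v ∈ fv {k = dl} (fml φ)) →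
    (F : Approximation ℝ) →
    (δ : ℚ) → 0ℚ < δ → δ < ½ →
    (I : Term (Symbol ℝ) Var → IQ) → Enclosure 1ℚ φ I →
    (φ∀ φ∃ : Fml ⊥ fo) → Perturbation ℝ all δ F φ φ∀ → Perturbation ℝ ex δ F φ φ∃ →
    let premise = approximationPremise φ F δ I
        conclusion∀ = closure xs I (lift φ∀ →̇ fml φ)
        conclusion∃ = closure xs I (fml φ →̇ lift φ∃)
    in (SoundRule premise conclusion∀ × SoundRule premise conclusion∃) ×
       (ProvableEnclosure 1ℚ φ I →
          DerivableRule premise conclusion∀ × DerivableRule premise conclusion∃)
theorem4p14 _ ℝ J φ scoped xs unique xs⇔fv F δ _ _ I encl φ∀ φ∃ p∀ p∃ =
    (rule-sound ℝ J scoped unique fv⊆xs encl all p∀ , rule-sound ℝ J scoped unique fv⊆xs encl ex p∃)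
  , λ prov → rule-derivable ℝ J scoped unique fv⊆xs encl prov all p∀
           , rule-derivable ℝ J scoped unique fv⊆xs encl prov ex p∃
  where
  fv⊆xs : ∀ {v} → v ∈ fv {k = dl} (fml φ) → v ∈ xs
  fv⊆xs = Equivalence.from (xs⇔fv _)
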